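{- Let $p\geq 3$ be prime, let $f'>1$ be an odd integer divisible by $p$, and let $n\geq 1$. Set $f=p^nf'$ and $$H_{p^n}=\{1+kf';\ 0\leq k\leq p^n-1\}=\ker\left((\mathbb{Z}/f\mathbb{Z})^*\twoheadrightarrow(\mathbb{Z}/f'\mathbb{Z})^*\right),$$ a subgroup of order $p^n$ of $(\mathbb{Z}/f\mathbb{Z})^*$. Then $T(H_{p^n},f):=\sum_{k=0}^{p^n-1}(1+kf')=p^n+\frac{p^n-1}{2}f$, hence $\gcd(f,T(H_{p^n},f))=p^n$, and $$S(H_{p^n},f):=\sum_{h\in H_{p^n}}s(h,f)=\sum_{k=0}^{p^n-1}s(1+kf',f)=\frac{p^{n+1}+p^n-1}{12p^{n+1}}f-\frac{p^n}{4}+\frac{p^n}{6f}.$$ Consequently, the rational number $2\gcd(3,f)\frac{f}{p^n}S(H_{p^n},f)$ is an integer not divisible by $p$, and it is odd if and only if $f\equiv 3\pmod 4$.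
   Context: For $d>1$ and $\gcd(c,d)=1$, the Dedekind sum is $s(c,d):=\frac{1}{4d}\sum_{a=1}^{d-1}\cot\left(\frac{\pi a}{d}\right)\cot\left(\frac{\pi a c}{d}\right)$; it depends only on $c$ modulo $d$. -}

module Defs where

open import Data.Nat as ℕ using (ℕ; zero; suc; _+_; _*_; _∸_; _^_)
open import Data.Nat.DivMod using (_%_)
open import Data.Integer as ℤ using (ℤ; +_)
open import Data.Rational as ℚ using (ℚ; 0ℚ; _/_)
open import Relation.Nullary using (yes; no)

-- total division of an integer by a natural number; only used with
-- denominators that are provably nonzero under the hypotheses
divQ : ℤ → ℕ → ℚ
divQ a zero    = 0ℚ
divQ a (suc d) = a / suc d

ΣQ : ℕ → (ℕ → ℚ) → ℚ
ΣQ zero    g = 0ℚ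
ΣQ (suc n) g = ΣQ n g ℚ.+ g n

ΣN : ℕ → (ℕ → ℕ) → ℕ
ΣN zero    g = 0
ΣN (suc n) g = ΣN n g + g n

-- sawtooth ((a/d)) for d > 0: 0 if d ∣ a, else {a/d} - 1/2
saw : ℕ → ℕ → ℚ
saw a d with a % suc (d ∸ 1) ℕ.≟ 0
... | yes _ = 0ℚ
... | no  _ = divQ (+ (a % suc (d ∸ 1))) d ℚ.- divQ (+ 1) 2

dedekind : ℕ → ℕ → ℚ
dedekind c d = ΣQ (d ∸ 1) (λ i → saw (suc i) d ℚ.* saw (suc i * c) d)

-- Clearing denominators, sawℤ d a = 2d((a/d)) turns s(c,d) into (2d)⁻² Σₐ sawℤ d a · sawℤ d (ac),
-- and S(H_N, f) into an integer double sum Sℤ N f′ over a < f and k < N, where N = p^e.  Split a by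
-- its residue mod p.  For p ∤ a, k ↦ a (1 + k f′) runs through a + f′·(every residue mod N), so the
-- distribution relation collapses the inner sum to N sawℤ f′ a, and what remains are correlations
-- Σₘ sawℤ (L d) m · sawℤ d m = L Σᵣ (sawℤ d r)², known in closed form.  For a = p q everything
-- scales by p and the sum for exponent e − 1 reappears.  The resulting recursion in e solves to
-- 3 Sℤ = N² f′ V, i.e. S = V / 12f′, which is the stated formula.  Finally
-- 2 gcd(3,f) (f/N) S = gcd(3,f) V / 6 with V = 2U, where U ≡ 1 (mod p), U ≡ 1 + a + b (mod 2) for
-- f′ = 3 + 2a and N = 1 + 2b, and 3 ∣ U as soon as 3 ∤ f.
module Submission where

open import Defs
open import Data.Nat as ℕ using (ℕ; zero; suc; NonZero; _≤_; _<_; _∸_; _^_; z≤n; s≤s)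
import Data.Nat.Properties as ℕₚ
open import Data.Nat.DivMod using (_%_; m≡m%n+[m/n]*n; m%n<n; m<n⇒m%n≡m; [m+kn]%n≡m%n; %-distribˡ-+; %-distribˡ-*; m*n/n≡m)
open import Data.Nat.Divisibility
  using (_∣_; _∣?_; divides; quotient≢0; ∣-refl; ∣-trans; ∣-antisym; >⇒∤; ∣⇒≤; ∣1⇒≡1; m%n≡0⇒n∣m;
         ∣m+n∣m⇒∣n; ∣m∣n⇒∣m+n; m∣m*n; n∣m*n; ∣m⇒∣m*n; ∣n⇒∣m*n)
open import Data.Nat.GCD using (gcd; gcd[m,n]∣m; gcd[m,n]∣n; gcd-greatest)
open import Data.Nat.Coprimality as Coprimality using (Coprime; coprime-divisor; 1-coprimeTo)
open import Data.Nat.Primality using (Prime; prime?; prime[2]; prime⇒irreducible; prime⇒nonZero)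
import Data.Nat.Tactic.RingSolver as ℕ-Solver
open import Data.Integer using (ℤ; +_; ∣_∣)
import Data.Integer.Properties as ℤₚ
open import Data.Integer.Tactic.RingSolver using (solve-∀)
open import Data.Rational as ℚ using (ℚ; toℚᵘ)
import Data.Rational.Properties as ℚₚ
open import Data.Rational.Unnormalised as ℚᵘ using (ℚᵘ; _≃_; *≡*)
import Data.Rational.Unnormalised.Properties as ℚᵘₚ
open import Data.Fin using (Fin; toℕ; fromℕ<; punchOut)
import Data.Fin.Properties as Finₚ
open import Data.Fin.Permutation using (Permutation; permutation)
open import Data.Product using (∃; _×_; _,_; proj₁; proj₂)
open import Data.Sum using (_⊎_; inj₁; inj₂)
open import Function using (_∘_)
open import Function.Bundles using (_⇔_; mk⇔; Equivalence)
open import Relation.Nullary using (¬_; yes; no)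
open import Relation.Nullary.Decidable using (from-yes)
open import Relation.Nullary.Negation using (contradiction)
open import Relation.Binary.PropositionalEquality

cong₃ : ∀ {A B C D : Set} (f : A → B → C → D) {a a′ b b′ c c′} → a ≡ a′ → b ≡ b′ → c ≡ c′ → f a b c ≡ f a′ b′ c′
cong₃ f refl refl refl = refl

module IntegerSums where

  open import Data.Integer using (_+_; _*_; _-_)

  ΣZ : ℕ → (ℕ → ℤ) → ℤ
  ΣZ zero    g = + 0
  ΣZ (suc n) g = ΣZ n g + g n

  ΣZ-cong : ∀ n {g h : ℕ → ℤ} → (∀ i → i < n → g i ≡ h i) → ΣZ n g ≡ ΣZ n h
  ΣZ-cong zero    eq = refl
  ΣZ-cong (suc n) eq = cong₂ _+_ (ΣZ-cong n (λ i i<n → eq i (ℕₚ.m<n⇒m<1+n i<n))) (eq n ℕₚ.≤-refl)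

  ΣZ-distrib-+ : ∀ n (g h : ℕ → ℤ) → ΣZ n (λ i → g i + h i) ≡ ΣZ n g + ΣZ n h
  ΣZ-distrib-+ zero    g h = refl
  ΣZ-distrib-+ (suc n) g h = trans (cong (_+ (g n + h n)) (ΣZ-distrib-+ n g h)) (interchange (ΣZ n g) (ΣZ n h) (g n) (h n))
    where
    interchange : ∀ a b c d → (a + b) + (c + d) ≡ (a + c) + (b + d)
    interchange = solve-∀

  ΣZ-*ˡ : ∀ n c (g : ℕ → ℤ) → ΣZ n (λ i → c * g i) ≡ c * ΣZ n g
  ΣZ-*ˡ zero    c g = sym (ℤₚ.*-zeroʳ c)
  ΣZ-*ˡ (suc n) c g = trans (cong (_+ c * g n) (ΣZ-*ˡ n c g)) (sym (ℤₚ.*-distribˡ-+ c (ΣZ n g) (g n)))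

  ΣZ-*ʳ : ∀ n c (g : ℕ → ℤ) → ΣZ n (λ i → g i * c) ≡ ΣZ n g * c
  ΣZ-*ʳ n c g = trans (ΣZ-cong n (λ i _ → ℤₚ.*-comm (g i) c)) (trans (ΣZ-*ˡ n c g) (ℤₚ.*-comm c (ΣZ n g)))

  ΣZ-const : ∀ n c → ΣZ n (λ _ → c) ≡ + n * c
  ΣZ-const zero    c = sym (ℤₚ.*-zeroˡ c)
  ΣZ-const (suc n) c = trans (cong (_+ c) (ΣZ-const n c)) (step (+ n) c)
    where
    step : ∀ n c → n * c + c ≡ (+ 1 + n) * c
    step = solve-∀

  ΣZ-comm : ∀ m n (g : ℕ → ℕ → ℤ) → ΣZ m (λ i → ΣZ n (g i)) ≡ ΣZ n (λ j → ΣZ m (λ i → g i j))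
  ΣZ-comm zero    n g = sym (trans (ΣZ-const n (+ 0)) (ℤₚ.*-zeroʳ (+ n)))
  ΣZ-comm (suc m) n g =
    trans (cong (_+ ΣZ n (g m)) (ΣZ-comm m n g)) (sym (ΣZ-distrib-+ n (λ j → ΣZ m (λ i → g i j)) (g m)))

  ΣZ-split : ∀ m n (g : ℕ → ℤ) → ΣZ (m ℕ.+ n) g ≡ ΣZ m g + ΣZ n (λ i → g (m ℕ.+ i))
  ΣZ-split m zero    g = trans (cong (λ k → ΣZ k g) (ℕₚ.+-identityʳ m)) (sym (ℤₚ.+-identityʳ _))
  ΣZ-split m (suc n) g = begin
    ΣZ (m ℕ.+ suc n) g                                   ≡⟨ cong (λ k → ΣZ k g) (ℕₚ.+-suc m n) ⟩
    ΣZ (m ℕ.+ n) g + g (m ℕ.+ n)                         ≡⟨ cong (_+ g (m ℕ.+ n)) (ΣZ-split m n g) ⟩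
    (ΣZ m g + ΣZ n (λ i → g (m ℕ.+ i))) + g (m ℕ.+ n)   ≡⟨ ℤₚ.+-assoc (ΣZ m g) _ _ ⟩
    ΣZ m g + ΣZ (suc n) (λ i → g (m ℕ.+ i))              ∎
    where open ≡-Reasoning

  ΣZ-head : ∀ n (g : ℕ → ℤ) → ΣZ (suc n) g ≡ g 0 + ΣZ n (g ∘ suc)
  ΣZ-head n g = trans (ΣZ-split 1 n g) (cong (_+ ΣZ n (g ∘ suc)) (ℤₚ.+-identityˡ (g 0)))

  ΣZ-blocks : ∀ m n (g : ℕ → ℤ) → ΣZ (m ℕ.* n) g ≡ ΣZ m (λ q → ΣZ n (λ r → g (q ℕ.* n ℕ.+ r)))
  ΣZ-blocks zero    n g = refl
  ΣZ-blocks (suc m) n g = begin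
    ΣZ (n ℕ.+ m ℕ.* n) g                              ≡⟨ cong (λ k → ΣZ k g) (ℕₚ.+-comm n (m ℕ.* n)) ⟩
    ΣZ (m ℕ.* n ℕ.+ n) g                              ≡⟨ ΣZ-split (m ℕ.* n) n g ⟩
    ΣZ (m ℕ.* n) g + ΣZ n (λ r → g (m ℕ.* n ℕ.+ r))  ≡⟨ cong (_+ ΣZ n (λ r → g (m ℕ.* n ℕ.+ r))) (ΣZ-blocks m n g) ⟩
    ΣZ (suc m) (λ q → ΣZ n (λ r → g (q ℕ.* n ℕ.+ r))) ∎
    where open ≡-Reasoning

  ΣZ-periodic-blocks : ∀ m n (g : ℕ → ℤ) → (∀ q r → g (q ℕ.* n ℕ.+ r) ≡ g r) → ΣZ (m ℕ.* n) g ≡ + m * ΣZ n g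
  ΣZ-periodic-blocks m n g periodic = begin
    ΣZ (m ℕ.* n) g                                   ≡⟨ ΣZ-blocks m n g ⟩
    ΣZ m (λ q → ΣZ n (λ r → g (q ℕ.* n ℕ.+ r)))     ≡⟨ ΣZ-cong m (λ q _ → ΣZ-cong n (λ r _ → periodic q r)) ⟩
    ΣZ m (λ _ → ΣZ n g)                              ≡⟨ ΣZ-const m (ΣZ n g) ⟩
    + m * ΣZ n g                                     ∎
    where open ≡-Reasoning

  ΣZ-shift-periodic : ∀ n (g : ℕ → ℤ) → (∀ x → g (x ℕ.+ n) ≡ g x) → ∀ u → ΣZ n (λ t → g (u ℕ.+ t)) ≡ ΣZ n g
  ΣZ-shift-periodic n       g periodic zero    = refl
  ΣZ-shift-periodic zero    g periodic (suc u) = refl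
  ΣZ-shift-periodic (suc n) g periodic (suc u) = begin
    ΣZ n (λ t → g (suc u ℕ.+ t)) + g (suc u ℕ.+ n)  ≡⟨ cong₂ _+_ (ΣZ-cong n (λ t _ → cong g (sym (ℕₚ.+-suc u t))))
                                                                 (trans (cong g (sym (ℕₚ.+-suc u n))) (periodic u)) ⟩
    ΣZ n (λ t → g (u ℕ.+ suc t)) + g u              ≡⟨ ℤₚ.+-comm _ (g u) ⟩
    g u + ΣZ n (λ t → g (u ℕ.+ suc t))              ≡⟨ cong (λ x → g x + ΣZ n (λ t → g (u ℕ.+ suc t))) (sym (ℕₚ.+-identityʳ u)) ⟩
    g (u ℕ.+ 0) + ΣZ n (λ t → g (u ℕ.+ suc t))      ≡⟨ sym (ΣZ-head n (λ t → g (u ℕ.+ t))) ⟩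
    ΣZ (suc n) (λ t → g (u ℕ.+ t))                  ≡⟨ ΣZ-shift-periodic (suc n) g periodic u ⟩
    ΣZ (suc n) g                                    ∎
    where open ≡-Reasoning

  ΣZ-arithmetic : ∀ n a b → + 2 * ΣZ n (λ t → a + b * + t) ≡ + n * (+ 2 * a + b * (+ n - + 1))
  ΣZ-arithmetic zero    a b = refl
  ΣZ-arithmetic (suc n) a b = begin
    + 2 * (ΣZ n (λ t → a + b * + t) + (a + b * + n))          ≡⟨ ℤₚ.*-distribˡ-+ (+ 2) (ΣZ n (λ t → a + b * + t)) (a + b * + n) ⟩
    + 2 * ΣZ n (λ t → a + b * + t) + + 2 * (a + b * + n)      ≡⟨ cong (_+ + 2 * (a + b * + n)) (ΣZ-arithmetic n a b) ⟩
    + n * (+ 2 * a + b * (+ n - + 1)) + + 2 * (a + b * + n)   ≡⟨ step (+ n) a b ⟩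
    (+ 1 + + n) * (+ 2 * a + b * ((+ 1 + + n) - + 1))         ∎
    where
    open ≡-Reasoning
    step : ∀ n a b → n * (+ 2 * a + b * (n - + 1)) + + 2 * (a + b * n) ≡ (+ 1 + n) * (+ 2 * a + b * ((+ 1 + n) - + 1))
    step = solve-∀

  ΣZ-squares : ∀ n a b → + 6 * ΣZ n (λ t → (a + b * + t) * (a + b * + t))
             ≡ + n * (+ 6 * a * a + + 6 * a * b * (+ n - + 1) + b * b * (+ n - + 1) * (+ 2 * + n - + 1))
  ΣZ-squares zero    a b = refl
  ΣZ-squares (suc n) a b = begin
    + 6 * (ΣZ n sq + (a + b * + n) * (a + b * + n))               ≡⟨ ℤₚ.*-distribˡ-+ (+ 6) (ΣZ n sq) _ ⟩
    + 6 * ΣZ n sq + + 6 * ((a + b * + n) * (a + b * + n))          ≡⟨ cong (_+ + 6 * ((a + b * + n) * (a + b * + n))) (ΣZ-squares n a b) ⟩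
    _                                                              ≡⟨ step (+ n) a b ⟩
    _                                                              ∎
    where
    open ≡-Reasoning
    sq : ℕ → ℤ
    sq t = (a + b * + t) * (a + b * + t)
    step : ∀ n a b → n * (+ 6 * a * a + + 6 * a * b * (n - + 1) + b * b * (n - + 1) * (+ 2 * n - + 1)) + + 6 * ((a + b * n) * (a + b * n))
                   ≡ (+ 1 + n) * (+ 6 * a * a + + 6 * a * b * ((+ 1 + n) - + 1) + b * b * ((+ 1 + n) - + 1) * (+ 2 * (+ 1 + n) - + 1))
    step = solve-∀

  ΣZ-split-multiples : ∀ m n .{{_ : NonZero n}} (g : ℕ → ℤ) →
    ΣZ (m ℕ.* n) g ≡ ΣZ m (λ q → g (q ℕ.* n)) + ΣZ m (λ q → ΣZ (ℕ.pred n) (λ r → g (q ℕ.* n ℕ.+ suc r)))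
  ΣZ-split-multiples m (suc n) g = begin
    ΣZ (m ℕ.* suc n) g                                                      ≡⟨ ΣZ-blocks m (suc n) g ⟩
    ΣZ m (λ q → ΣZ (suc n) (λ r → g (q ℕ.* suc n ℕ.+ r)))                   ≡⟨ ΣZ-cong m (λ q _ → ΣZ-head n _) ⟩
    ΣZ m (λ q → g (q ℕ.* suc n ℕ.+ 0) + ΣZ n (λ r → g (q ℕ.* suc n ℕ.+ suc r)))
                                                                            ≡⟨ ΣZ-distrib-+ m _ _ ⟩
    ΣZ m (λ q → g (q ℕ.* suc n ℕ.+ 0)) + ΣZ m (λ q → ΣZ n (λ r → g (q ℕ.* suc n ℕ.+ suc r)))
                                                                            ≡⟨ cong (_+ ΣZ m (λ q → ΣZ n (λ r → g (q ℕ.* suc n ℕ.+ suc r))))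
                                                                                    (ΣZ-cong m (λ q _ → cong g (ℕₚ.+-identityʳ _))) ⟩
    ΣZ m (λ q → g (q ℕ.* suc n)) + ΣZ m (λ q → ΣZ n (λ r → g (q ℕ.* suc n ℕ.+ suc r)))
                                                                            ∎
    where open ≡-Reasoning

  Fin-injective⇒surjective : ∀ {n} (σ : Fin n → Fin n) → (∀ {i j} → σ i ≡ σ j → i ≡ j) → ∀ j → ∃ λ i → σ i ≡ j
  Fin-injective⇒surjective {suc n} σ σ-inj j with Finₚ.any? (λ i → σ i Finₚ.≟ j)
  ... | yes hit = hit
  ... | no miss = contradiction (Finₚ.injective⇒≤ {f = σ-avoiding-j} σ-avoiding-j-inj) ℕₚ.1+n≰n
    where
    j≢σ : ∀ i → j ≢ σ i
    j≢σ i eq = miss (i , sym eq)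
    σ-avoiding-j : Fin (suc n) → Fin n
    σ-avoiding-j i = punchOut (j≢σ i)
    σ-avoiding-j-inj : ∀ {x y} → σ-avoiding-j x ≡ σ-avoiding-j y → x ≡ y
    σ-avoiding-j-inj {x} {y} eq = σ-inj (Finₚ.punchOut-injective (j≢σ x) (j≢σ y) eq)

  ΣZ-permute : ∀ n (σ : ℕ → ℕ) (g : ℕ → ℤ) → (∀ k → k < n → σ k < n) →
               (∀ {i j} → i < n → j < n → σ i ≡ σ j → i ≡ j) → ΣZ n (g ∘ σ) ≡ ΣZ n g
  ΣZ-permute n σ g σ<n σ-inj = begin
    ΣZ n (g ∘ σ)                  ≡⟨ ΣZ-Fin n (g ∘ σ) ⟩
    sum {n} (λ i → g (σ (toℕ i))) ≡⟨ sum-cong-≗ (λ i → cong g (sym (Finₚ.toℕ-fromℕ< (σ<n (toℕ i) (Finₚ.toℕ<n i))))) ⟩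
    sum {n} (λ i → g (toℕ (σ̂ i))) ≡⟨ sym (sum-permute (g ∘ toℕ) π) ⟩
    sum {n} (g ∘ toℕ)             ≡⟨ sym (ΣZ-Fin n g) ⟩
    ΣZ n g                        ∎
    where
    open ≡-Reasoning
    open import Algebra.Properties.CommutativeMonoid.Sum ℤₚ.+-0-commutativeMonoid using (sum; sum-permute; sum-cong-≗)
    ΣZ-Fin : ∀ n (g : ℕ → ℤ) → ΣZ n g ≡ sum {n} (g ∘ toℕ)
    ΣZ-Fin zero    g = refl
    ΣZ-Fin (suc n) g = trans (ΣZ-head n g) (cong (λ s → g 0 + s) (ΣZ-Fin n (g ∘ suc)))
    σ̂ : Fin n → Fin n
    σ̂ i = fromℕ< (σ<n (toℕ i) (Finₚ.toℕ<n i))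
    σ̂-inj : ∀ {i j} → σ̂ i ≡ σ̂ j → i ≡ j
    σ̂-inj {i} {j} eq = Finₚ.toℕ-injective (σ-inj (Finₚ.toℕ<n i) (Finₚ.toℕ<n j)
      (trans (sym (Finₚ.toℕ-fromℕ< _)) (trans (cong toℕ eq) (Finₚ.toℕ-fromℕ< _))))
    σ̂⁻¹ : Fin n → Fin n
    σ̂⁻¹ j = proj₁ (Fin-injective⇒surjective σ̂ σ̂-inj j)
    π : Permutation n n
    π = permutation σ̂ σ̂⁻¹ (λ j → proj₂ (Fin-injective⇒surjective σ̂ σ̂-inj j))
                          (λ i → σ̂-inj (proj₂ (Fin-injective⇒surjective σ̂ σ̂-inj (σ̂ i))))

module Residues where

  open import Data.Nat using (_+_; _*_; _/_)

  %-≡⇒∣∸ : ∀ m o n .{{_ : NonZero n}} → m % n ≡ o % n → n ∣ m ∸ o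
  %-≡⇒∣∸ m o n eq = divides (m / n ∸ o / n) (begin
    m ∸ o                                       ≡⟨ cong₂ _∸_ (m≡m%n+[m/n]*n m n) (trans (m≡m%n+[m/n]*n o n) (cong (_+ o / n * n) (sym eq))) ⟩
    (m % n + m / n * n) ∸ (m % n + o / n * n)   ≡⟨ ℕₚ.[m+n]∸[m+o]≡n∸o (m % n) _ _ ⟩
    m / n * n ∸ o / n * n                       ≡⟨ sym (ℕₚ.*-distribʳ-∸ n (m / n) (o / n)) ⟩
    (m / n ∸ o / n) * n                         ∎)
    where open ≡-Reasoning

  ∣∧<⇒≡0 : ∀ {n m} → n ∣ m → m < n → m ≡ 0
  ∣∧<⇒≡0 {m = zero}  _   _   = refl
  ∣∧<⇒≡0 {m = suc m} n∣m m<n = contradiction n∣m (>⇒∤ m<n)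

  *-%-injective : ∀ {n a} .{{_ : NonZero n}} → Coprime n a → ∀ {i j} → i < n → j < n →
                  (a * i) % n ≡ (a * j) % n → i ≡ j
  *-%-injective {n} {a} coprime i<n j<n eq = ℕₚ.≤-antisym (≤-from i<n eq) (≤-from j<n (sym eq))
    where
    ≤-from : ∀ {i j} → i < n → (a * i) % n ≡ (a * j) % n → i ≤ j
    ≤-from {i} {j} i<n eq = ℕₚ.m∸n≡0⇒m≤n (∣∧<⇒≡0 n∣i∸j (ℕₚ.≤-<-trans (ℕₚ.m∸n≤m i j) i<n))
      where
      n∣i∸j : n ∣ i ∸ j
      n∣i∸j = coprime-divisor coprime (subst (n ∣_) (sym (ℕₚ.*-distribˡ-∸ a i j)) (%-≡⇒∣∸ (a * i) (a * j) n eq))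

module CoprimeProducts where

  open import Data.Nat using (_*_)

  coprime-*ʳ : ∀ {a m n} → Coprime a m → Coprime a n → Coprime a (m * n)
  coprime-*ʳ a⊥m a⊥n (d∣a , d∣mn) = a⊥n (d∣a , coprime-divisor (λ (e∣d , e∣m) → a⊥m (∣-trans e∣d d∣a , e∣m)) d∣mn)

  coprime-^ʳ : ∀ {a m} → Coprime a m → ∀ e → Coprime a (m ^ e)
  coprime-^ʳ {a} a⊥m zero    = Coprimality.sym (1-coprimeTo a)
  coprime-^ʳ     a⊥m (suc e) = coprime-*ʳ a⊥m (coprime-^ʳ a⊥m e)

  coprime-∣ʳ : ∀ {a m n} → Coprime a n → m ∣ n → Coprime a m
  coprime-∣ʳ a⊥n m∣n (d∣a , d∣m) = a⊥n (d∣a , ∣-trans d∣m m∣n)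

  prime∤⇒coprime : ∀ {p a} → Prime p → ¬ p ∣ a → Coprime a p
  prime∤⇒coprime p-prime p∤a (d∣a , d∣p) with prime⇒irreducible p-prime d∣p
  ... | inj₁ d≡1    = d≡1
  ... | inj₂ refl   = contradiction d∣a p∤a

module Sawtooth where

  open IntegerSums
  open Residues
  open import Data.Nat using (_/_)
  open import Data.Integer using (_+_; _*_; _-_)

  -- sawℤ d a = 2d ((a/d)) is the sawtooth saw a d of Defs with its denominator cleared;
  -- sawʳ d r is its value at a residue r < d.
  sawʳ : ℕ → ℕ → ℤ
  sawʳ d zero    = + 0
  sawʳ d (suc r) = + (2 ℕ.* suc r) - + d

  sawℤ : ℕ → ℕ → ℤ
  sawℤ d a = sawʳ d (a % suc (d ∸ 1))

  sawℤ-periodic : ∀ d .{{_ : NonZero d}} a q → sawℤ d (a ℕ.+ q ℕ.* d) ≡ sawℤ d a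
  sawℤ-periodic (suc d) a q = cong (sawʳ (suc d)) ([m+kn]%n≡m%n a q (suc d))

  sawℤ-< : ∀ {d r} → r < d → sawℤ d r ≡ sawʳ d r
  sawℤ-< {suc d} r<d = cong (sawʳ (suc d)) (m<n⇒m%n≡m r<d)

  sawʳ-suc+ : ∀ d r x → sawʳ d (suc r ℕ.+ x) ≡ (+ 2 * + suc r - + d) + + 2 * + x
  sawʳ-suc+ d r x = trans (cong (_- + d) (trans (ℤₚ.pos-* 2 (suc r ℕ.+ x)) (cong (+ 2 *_) (ℤₚ.pos-+ (suc r) x))))
                          (rearrange (+ suc r) (+ x) (+ d))
    where
    rearrange : ∀ r x d → + 2 * (r + x) - d ≡ (+ 2 * r - d) + + 2 * x
    rearrange = solve-∀

  sawʳ-scale : ∀ p d r .{{_ : NonZero p}} → sawʳ (p ℕ.* d) (p ℕ.* r) ≡ + p * sawʳ d r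
  sawʳ-scale p d zero = trans (cong (sawʳ (p ℕ.* d)) (ℕₚ.*-zeroʳ p)) (sym (ℤₚ.*-zeroʳ (+ p)))
  sawʳ-scale (suc p) d (suc r) = begin
    + (2 ℕ.* (suc p ℕ.* suc r)) - + (suc p ℕ.* d)   ≡⟨ cong₂ _-_ (trans (ℤₚ.pos-* 2 (suc p ℕ.* suc r)) (cong (+ 2 *_) (ℤₚ.pos-* (suc p) (suc r))))
                                                               (ℤₚ.pos-* (suc p) d) ⟩
    + 2 * (+ suc p * + suc r) - + suc p * + d       ≡⟨ factor (+ suc p) (+ suc r) (+ d) ⟩
    + suc p * (+ 2 * + suc r - + d)                 ≡⟨ cong (λ x → + suc p * (x - + d)) (sym (ℤₚ.pos-* 2 (suc r))) ⟩
    + suc p * sawʳ d (suc r)                        ∎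
    where
    open ≡-Reasoning
    factor : ∀ p r d → + 2 * (p * r) - p * d ≡ p * (+ 2 * r - d)
    factor = solve-∀

  sawℤ-scale : ∀ p d a .{{_ : NonZero p}} .{{_ : NonZero d}} → sawℤ (p ℕ.* d) (p ℕ.* a) ≡ + p * sawℤ d a
  sawℤ-scale p@(suc _) d@(suc _) a = begin
    sawℤ (p ℕ.* d) (p ℕ.* a)                                  ≡⟨ cong (sawℤ (p ℕ.* d)) (split a) ⟩
    sawℤ (p ℕ.* d) (p ℕ.* (a % d) ℕ.+ a / d ℕ.* (p ℕ.* d))    ≡⟨ sawℤ-periodic (p ℕ.* d) (p ℕ.* (a % d)) (a / d) ⟩
    sawℤ (p ℕ.* d) (p ℕ.* (a % d))                            ≡⟨ sawℤ-< (ℕₚ.*-monoʳ-< p (m%n<n a d)) ⟩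
    sawʳ (p ℕ.* d) (p ℕ.* (a % d))                            ≡⟨ sawʳ-scale p d (a % d) ⟩
    + p * sawℤ d a                                            ∎
    where
    open ≡-Reasoning
    distribute : ∀ p r q d → p ℕ.* (r ℕ.+ q ℕ.* d) ≡ p ℕ.* r ℕ.+ q ℕ.* (p ℕ.* d)
    distribute = ℕ-Solver.solve-∀
    split : ∀ a → p ℕ.* a ≡ p ℕ.* (a % d) ℕ.+ a / d ℕ.* (p ℕ.* d)
    split a = trans (cong (p ℕ.*_) (m≡m%n+[m/n]*n a d)) (distribute p (a % d) (a / d) d)

  sawʳ-distribution : ∀ L Q .{{_ : NonZero L}} → ∀ r → r < Q →
                      ΣZ L (λ t → sawʳ (L ℕ.* Q) (r ℕ.+ Q ℕ.* t)) ≡ + L * sawʳ Q r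
  sawʳ-distribution (suc L) (suc Q) zero _ = begin
    ΣZ (suc L) (λ t → sawʳ LQ (QQ ℕ.* t))              ≡⟨ ΣZ-head L (λ t → sawʳ LQ (QQ ℕ.* t)) ⟩
    sawʳ LQ (QQ ℕ.* 0) + ΣZ L (λ t → sawʳ LQ (QQ ℕ.* suc t))
                                                         ≡⟨ cong₂ _+_ (cong (sawʳ LQ) (ℕₚ.*-zeroʳ QQ)) (ΣZ-cong L (λ t _ → term t)) ⟩
    + 0 + ΣZ L (λ t → a + + 2 * + QQ * + t)             ≡⟨ ℤₚ.+-identityˡ _ ⟩
    ΣZ L (λ t → a + + 2 * + QQ * + t)                   ≡⟨ ℤₚ.*-cancelˡ-≡ (+ 2) _ _ (trans (ΣZ-arithmetic L a (+ 2 * + QQ))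
                                                                                         (cancels (+ L) (+ QQ) (+ LQ) (ℤₚ.pos-* (suc L) QQ))) ⟩
    + 0                                                  ≡⟨ sym (ℤₚ.*-zeroʳ (+ suc L)) ⟩
    + suc L * sawʳ QQ 0                                  ∎
    where
    open ≡-Reasoning
    QQ LQ : ℕ
    QQ = suc Q
    LQ = suc L ℕ.* QQ
    a : ℤ
    a = + 2 * + QQ - + LQ
    term : ∀ t → sawʳ LQ (QQ ℕ.* suc t) ≡ a + + 2 * + QQ * + t
    term t = trans (cong (sawʳ LQ) (ℕₚ.*-suc QQ t)) (trans (sawʳ-suc+ LQ Q (QQ ℕ.* t))
                   (cong (λ x → a + x) (trans (cong (+ 2 *_) (ℤₚ.pos-* QQ t)) (sym (ℤₚ.*-assoc (+ 2) (+ QQ) (+ t))))))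
    cancels : ∀ L Q LQ → LQ ≡ (+ 1 + L) * Q → L * (+ 2 * (+ 2 * Q - LQ) + + 2 * Q * (L - + 1)) ≡ + 2 * + 0
    cancels L Q LQ refl = vanish L Q
      where
      vanish : ∀ L Q → L * (+ 2 * (+ 2 * Q - (+ 1 + L) * Q) + + 2 * Q * (L - + 1)) ≡ + 2 * + 0
      vanish = solve-∀
  sawʳ-distribution L@(suc _) Q (suc r) _ = ℤₚ.*-cancelˡ-≡ (+ 2) _ _ (begin
    + 2 * ΣZ L (λ t → sawʳ LQ (suc r ℕ.+ Q ℕ.* t))     ≡⟨ cong (+ 2 *_) (ΣZ-cong L (λ t _ → term t)) ⟩
    + 2 * ΣZ L (λ t → a + + 2 * + Q * + t)             ≡⟨ ΣZ-arithmetic L a (+ 2 * + Q) ⟩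
    + L * (+ 2 * a + + 2 * + Q * (+ L - + 1))           ≡⟨ collect (+ L) (+ suc r) (+ Q) (+ LQ) (ℤₚ.pos-* L Q) ⟩
    + 2 * (+ L * sawʳ Q (suc r))                        ∎)
    where
    open ≡-Reasoning
    LQ : ℕ
    LQ = L ℕ.* Q
    a : ℤ
    a = + 2 * + suc r - + LQ
    term : ∀ t → sawʳ LQ (suc r ℕ.+ Q ℕ.* t) ≡ a + + 2 * + Q * + t
    term t = trans (sawʳ-suc+ LQ r (Q ℕ.* t)) (cong (λ x → a + x) (trans (cong (+ 2 *_) (ℤₚ.pos-* Q t)) (sym (ℤₚ.*-assoc (+ 2) (+ Q) (+ t)))))
    collect : ∀ L r Q LQ → LQ ≡ L * Q → L * (+ 2 * (+ 2 * r - LQ) + + 2 * Q * (L - + 1)) ≡ + 2 * (L * (+ 2 * r - Q))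
    collect L r Q LQ refl = expand L r Q
      where
      expand : ∀ L r Q → L * (+ 2 * (+ 2 * r - L * Q) + + 2 * Q * (L - + 1)) ≡ + 2 * (L * (+ 2 * r - Q))
      expand = solve-∀

  -- the distribution relation Σ_{t<L} ((x + t/L)) = ((L x)) at x = r / LQ
  sawℤ-distribution : ∀ L Q .{{_ : NonZero L}} .{{_ : NonZero Q}} r →
                      ΣZ L (λ t → sawℤ (L ℕ.* Q) (r ℕ.+ Q ℕ.* t)) ≡ + L * sawℤ Q r
  sawℤ-distribution L@(suc _) Q@(suc _) r = begin
    ΣZ L (λ t → sawℤ (L ℕ.* Q) (r ℕ.+ Q ℕ.* t))       ≡⟨ ΣZ-cong L (λ t _ → cong (sawℤ (L ℕ.* Q)) (shift t)) ⟩
    ΣZ L (λ t → g (r / Q ℕ.+ t))                     ≡⟨ ΣZ-shift-periodic L g g-periodic (r / Q) ⟩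
    ΣZ L g                                           ≡⟨ ΣZ-cong L (λ t t<L → sawℤ-< (bounded t<L)) ⟩
    ΣZ L (λ t → sawʳ (L ℕ.* Q) (r % Q ℕ.+ Q ℕ.* t))  ≡⟨ sawʳ-distribution L Q (r % Q) (m%n<n r Q) ⟩
    + L * sawℤ Q r                                   ∎
    where
    open ≡-Reasoning
    g : ℕ → ℤ
    g x = sawℤ (L ℕ.* Q) (r % Q ℕ.+ Q ℕ.* x)
    regroup : ∀ r₀ u Q t → r₀ ℕ.+ u ℕ.* Q ℕ.+ Q ℕ.* t ≡ r₀ ℕ.+ Q ℕ.* (u ℕ.+ t)
    regroup = ℕ-Solver.solve-∀
    shift : ∀ t → r ℕ.+ Q ℕ.* t ≡ r % Q ℕ.+ Q ℕ.* (r / Q ℕ.+ t)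
    shift t = trans (cong (ℕ._+ Q ℕ.* t) (m≡m%n+[m/n]*n r Q)) (regroup (r % Q) (r / Q) Q t)
    one-period : ∀ r₀ Q x L → r₀ ℕ.+ Q ℕ.* (x ℕ.+ L) ≡ r₀ ℕ.+ Q ℕ.* x ℕ.+ 1 ℕ.* (L ℕ.* Q)
    one-period = ℕ-Solver.solve-∀
    g-periodic : ∀ x → g (x ℕ.+ L) ≡ g x
    g-periodic x = trans (cong (sawℤ (L ℕ.* Q)) (one-period (r % Q) Q x L)) (sawℤ-periodic (L ℕ.* Q) (r % Q ℕ.+ Q ℕ.* x) 1)
    bounded : ∀ {t} → t < L → r % Q ℕ.+ Q ℕ.* t < L ℕ.* Q
    bounded {t} t<L = ℕₚ.<-≤-trans (ℕₚ.+-monoˡ-< (Q ℕ.* t) (m%n<n r Q))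
      (subst (_≤ L ℕ.* Q) (ℕₚ.*-suc Q t) (subst (Q ℕ.* suc t ≤_) (ℕₚ.*-comm Q L) (ℕₚ.*-monoʳ-≤ Q t<L)))

  sawSquares : ℕ → ℤ
  sawSquares d = ΣZ d (λ r → sawℤ d r * sawℤ d r)

  sawSquares-closed : ∀ d .{{_ : NonZero d}} → + 3 * sawSquares d ≡ + d * (+ d - + 1) * (+ d - + 2)
  sawSquares-closed d@(suc d₀) = ℤₚ.*-cancelˡ-≡ (+ 2) _ _ (begin
    + 2 * (+ 3 * sawSquares d)                              ≡⟨ sym (ℤₚ.*-assoc (+ 2) (+ 3) (sawSquares d)) ⟩
    + 6 * sawSquares d                                      ≡⟨ cong (+ 6 *_) (ΣZ-head d₀ (λ r → sawℤ d r * sawℤ d r)) ⟩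
    + 6 * (+ 0 + ΣZ d₀ (λ t → sawℤ d (suc t) * sawℤ d (suc t)))
                                                            ≡⟨ cong (λ s → + 6 * s) (ℤₚ.+-identityˡ _) ⟩
    + 6 * ΣZ d₀ (λ t → sawℤ d (suc t) * sawℤ d (suc t))    ≡⟨ cong (+ 6 *_) (ΣZ-cong d₀ (λ t t<d₀ → cong₂ _*_ (term t<d₀) (term t<d₀))) ⟩
    + 6 * ΣZ d₀ (λ t → (a + + 2 * + t) * (a + + 2 * + t))  ≡⟨ ΣZ-squares d₀ a (+ 2) ⟩
    _                                                       ≡⟨ simplify (+ d₀) ⟩
    + 2 * (+ d * (+ d - + 1) * (+ d - + 2))                 ∎)
    where
    open ≡-Reasoning
    a : ℤ
    a = + 2 - + d
    term : ∀ {t} → t < d₀ → sawℤ d (suc t) ≡ a + + 2 * + t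
    term {t} t<d₀ = trans (sawℤ-< (s≤s t<d₀)) (trans (sawʳ-suc+ d 0 t) (cong (_+ + 2 * + t) (shape (+ d))))
      where
      shape : ∀ d → + 2 * + 1 - d ≡ + 2 - d
      shape = solve-∀
    simplify : ∀ n → n * (+ 6 * (+ 2 - (+ 1 + n)) * (+ 2 - (+ 1 + n)) + + 6 * (+ 2 - (+ 1 + n)) * + 2 * (n - + 1)
                         + + 2 * + 2 * (n - + 1) * (+ 2 * n - + 1))
                   ≡ + 2 * ((+ 1 + n) * ((+ 1 + n) - + 1) * ((+ 1 + n) - + 2))
    simplify = solve-∀

  sawℤ-correlation : ∀ L d .{{_ : NonZero L}} .{{_ : NonZero d}} →
                     ΣZ (L ℕ.* d) (λ m → sawℤ (L ℕ.* d) m * sawℤ d m) ≡ + L * sawSquares d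
  sawℤ-correlation L d = begin
    ΣZ (L ℕ.* d) (λ m → sawℤ (L ℕ.* d) m * sawℤ d m)
      ≡⟨ ΣZ-blocks L d _ ⟩
    ΣZ L (λ q → ΣZ d (λ r → sawℤ (L ℕ.* d) (q ℕ.* d ℕ.+ r) * sawℤ d (q ℕ.* d ℕ.+ r)))
      ≡⟨ ΣZ-cong L (λ q _ → ΣZ-cong d (λ r _ → reindex q r)) ⟩
    ΣZ L (λ q → ΣZ d (λ r → sawℤ (L ℕ.* d) (r ℕ.+ d ℕ.* q) * sawℤ d r))
      ≡⟨ ΣZ-comm L d _ ⟩
    ΣZ d (λ r → ΣZ L (λ q → sawℤ (L ℕ.* d) (r ℕ.+ d ℕ.* q) * sawℤ d r))
      ≡⟨ ΣZ-cong d (λ r _ → trans (ΣZ-*ʳ L (sawℤ d r) _) (cong (_* sawℤ d r) (sawℤ-distribution L d r))) ⟩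
    ΣZ d (λ r → + L * sawℤ d r * sawℤ d r)
      ≡⟨ ΣZ-cong d (λ r _ → ℤₚ.*-assoc (+ L) (sawℤ d r) (sawℤ d r)) ⟩
    ΣZ d (λ r → + L * (sawℤ d r * sawℤ d r))
      ≡⟨ ΣZ-*ˡ d (+ L) _ ⟩
    + L * sawSquares d
      ∎
    where
    open ≡-Reasoning
    reindex : ∀ q r → sawℤ (L ℕ.* d) (q ℕ.* d ℕ.+ r) * sawℤ d (q ℕ.* d ℕ.+ r) ≡ sawℤ (L ℕ.* d) (r ℕ.+ d ℕ.* q) * sawℤ d r
    reindex q r = cong₂ _*_ (cong (sawℤ (L ℕ.* d)) (trans (ℕₚ.+-comm (q ℕ.* d) r) (cong (r ℕ.+_) (ℕₚ.*-comm q d))))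
                            (trans (cong (sawℤ d) (ℕₚ.+-comm (q ℕ.* d) r)) (sawℤ-periodic d r q))

  -- k ↦ a k mod N permutes the residues, and a (1 + k f′) ≡ a + f′ (a k mod N)  (mod N f′)
  sawℤ-unit-orbit : ∀ N f′ a .{{_ : NonZero N}} .{{_ : NonZero f′}} → Coprime N a →
                    ΣZ N (λ k → sawℤ (N ℕ.* f′) (a ℕ.* (1 ℕ.+ k ℕ.* f′))) ≡ + N * sawℤ f′ a
  sawℤ-unit-orbit N@(suc _) f′@(suc _) a coprime = begin
    ΣZ N (λ k → sawℤ (N ℕ.* f′) (a ℕ.* (1 ℕ.+ k ℕ.* f′)))  ≡⟨ ΣZ-cong N (λ k _ → reduce k) ⟩
    ΣZ N (g ∘ σ)                                           ≡⟨ ΣZ-permute N σ g (λ k _ → m%n<n (a ℕ.* k) N) (*-%-injective coprime) ⟩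
    ΣZ N g                                                 ≡⟨ sawℤ-distribution N f′ a ⟩
    + N * sawℤ f′ a                                        ∎
    where
    open ≡-Reasoning
    g : ℕ → ℤ
    g x = sawℤ (N ℕ.* f′) (a ℕ.+ f′ ℕ.* x)
    σ : ℕ → ℕ
    σ k = (a ℕ.* k) % N
    expand : ∀ a k f′ r q N → a ℕ.* k ≡ r ℕ.+ q ℕ.* N → a ℕ.* (1 ℕ.+ k ℕ.* f′) ≡ a ℕ.+ f′ ℕ.* r ℕ.+ q ℕ.* (N ℕ.* f′)
    expand a k f′ r q N eq = trans (left a k f′) (trans (cong (λ x → a ℕ.+ f′ ℕ.* x) eq) (right a f′ r q N))
      where
      left : ∀ a k f′ → a ℕ.* (1 ℕ.+ k ℕ.* f′) ≡ a ℕ.+ f′ ℕ.* (a ℕ.* k)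
      left = ℕ-Solver.solve-∀
      right : ∀ a f′ r q N → a ℕ.+ f′ ℕ.* (r ℕ.+ q ℕ.* N) ≡ a ℕ.+ f′ ℕ.* r ℕ.+ q ℕ.* (N ℕ.* f′)
      right = ℕ-Solver.solve-∀
    reduce : ∀ k → sawℤ (N ℕ.* f′) (a ℕ.* (1 ℕ.+ k ℕ.* f′)) ≡ g (σ k)
    reduce k = trans (cong (sawℤ (N ℕ.* f′)) (expand a k f′ (σ k) ((a ℕ.* k) / N) N (m≡m%n+[m/n]*n (a ℕ.* k) N)))
                     (sawℤ-periodic (N ℕ.* f′) (a ℕ.+ f′ ℕ.* σ k) ((a ℕ.* k) / N))

module DedekindSums where

  open IntegerSums
  open Sawtooth
  open import Data.Integer using (_+_; _*_; _-_)

  dedekindℤ : ℕ → ℕ → ℤ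
  dedekindℤ c d = ΣZ d (λ a → sawℤ d a * sawℤ d (a ℕ.* c))

  -- Sℤ N f′ = (2f)² S(H_N, f) for f = N f′
  Sℤ : ℕ → ℕ → ℤ
  Sℤ N f′ = ΣZ N (λ k → dedekindℤ (1 ℕ.+ k ℕ.* f′) (N ℕ.* f′))

  Sℤ-by-residue : ∀ N f′ →
    Sℤ N f′ ≡ ΣZ (N ℕ.* f′) (λ a → sawℤ (N ℕ.* f′) a * ΣZ N (λ k → sawℤ (N ℕ.* f′) (a ℕ.* (1 ℕ.+ k ℕ.* f′))))
  Sℤ-by-residue N f′ = trans (ΣZ-comm N (N ℕ.* f′) _) (ΣZ-cong (N ℕ.* f′) (λ a _ →
    ΣZ-*ˡ N (sawℤ (N ℕ.* f′) a) (λ k → sawℤ (N ℕ.* f′) (a ℕ.* (1 ℕ.+ k ℕ.* f′)))))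

  Sℤ-base : ∀ f′ → Sℤ 1 f′ ≡ sawSquares f′
  Sℤ-base f′ = trans (ℤₚ.+-identityˡ _) (trans (cong (dedekindℤ 1) (ℕₚ.+-identityʳ f′))
                                           (ΣZ-cong f′ (λ a _ → cong (λ x → sawℤ f′ a * sawℤ f′ x) (ℕₚ.*-identityʳ a))))

  -- S-numerator N f′ h = 12 f′ S(H_N, N f′) when f′ = p h and N = p^e (Formula.S≃V/12f′)
  S-numerator : ℤ → ℤ → ℤ → ℤ
  S-numerator N g h = N * g * g - + 3 * N * g + N * g * h - g * h + + 2

module Recursion {p f′ h : ℕ} (p-prime : Prime p) (f′≡ph : f′ ≡ p ℕ.* h) .{{_ : NonZero h}} where

  open IntegerSums
  open Sawtooth
  open CoprimeProducts
  open DedekindSums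
  open import Data.Integer using (_+_; _*_; _-_)

  instance
    p≢0 : NonZero p
    p≢0 = prime⇒nonZero p-prime
    f′≢0 : NonZero f′
    f′≢0 = subst NonZero (sym f′≡ph) (ℕₚ.m*n≢0 p h)

  module Step (e : ℕ) where

    N N′ M F : ℕ
    N = p ^ e
    N′ = p ^ suc e
    M = N ℕ.* f′
    F = N′ ℕ.* f′

    instance
      N≢0 : NonZero N
      N≢0 = ℕₚ.m^n≢0 p e
      N′≢0 : NonZero N′
      N′≢0 = ℕₚ.m^n≢0 p (suc e)
      M≢0 : NonZero M
      M≢0 = ℕₚ.m*n≢0 N f′

    orbit : ℕ → ℕ → ℕ → ℤ
    orbit L d a = ΣZ L (λ k → sawℤ d (a ℕ.* (1 ℕ.+ k ℕ.* f′)))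

    term : ℕ → ℤ
    term a = sawℤ F a * orbit N′ F a

    correlation : ℕ → ℤ
    correlation a = sawℤ F a * sawℤ f′ a

    scale : ∀ x → sawℤ F (p ℕ.* x) ≡ + p * sawℤ M x
    scale x = trans (cong (λ d → sawℤ d (p ℕ.* x)) (ℕₚ.*-assoc p N f′)) (sawℤ-scale p M x)

    orbit-periodic : ∀ q j r → sawℤ M (q ℕ.* (1 ℕ.+ (j ℕ.* N ℕ.+ r) ℕ.* f′)) ≡ sawℤ M (q ℕ.* (1 ℕ.+ r ℕ.* f′))
    orbit-periodic q j r = trans (cong (sawℤ M) (regroup q j N r f′)) (sawℤ-periodic M (q ℕ.* (1 ℕ.+ r ℕ.* f′)) (q ℕ.* j))
      where
      regroup : ∀ q j N r f′ → q ℕ.* (1 ℕ.+ (j ℕ.* N ℕ.+ r) ℕ.* f′) ≡ q ℕ.* (1 ℕ.+ r ℕ.* f′) ℕ.+ q ℕ.* j ℕ.* (N ℕ.* f′)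
      regroup = ℕ-Solver.solve-∀

    term-multiple : ∀ q → term (q ℕ.* p) ≡ + p * + p * + p * (sawℤ M q * orbit N M q)
    term-multiple q = begin
      sawℤ F (q ℕ.* p) * orbit N′ F (q ℕ.* p)
        ≡⟨ cong₂ _*_ (trans (cong (sawℤ F) (ℕₚ.*-comm q p)) (scale q))
                     (ΣZ-cong N′ (λ k _ → trans (cong (sawℤ F) (reassoc q p k f′)) (scale _))) ⟩
      (+ p * sawℤ M q) * ΣZ N′ (λ k → + p * sawℤ M (q ℕ.* (1 ℕ.+ k ℕ.* f′)))
        ≡⟨ cong ((+ p * sawℤ M q) *_) (trans (ΣZ-*ˡ N′ (+ p) _) (cong (+ p *_) (ΣZ-periodic-blocks p N _ (orbit-periodic q)))) ⟩
      (+ p * sawℤ M q) * (+ p * (+ p * orbit N M q))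
        ≡⟨ collect (+ p) (sawℤ M q) (orbit N M q) ⟩
      + p * + p * + p * (sawℤ M q * orbit N M q)
        ∎
      where
      open ≡-Reasoning
      reassoc : ∀ q p k f′ → q ℕ.* p ℕ.* (1 ℕ.+ k ℕ.* f′) ≡ p ℕ.* (q ℕ.* (1 ℕ.+ k ℕ.* f′))
      reassoc = ℕ-Solver.solve-∀
      collect : ∀ p w s → (p * w) * (p * (p * s)) ≡ p * p * p * (w * s)
      collect = solve-∀

    term-non-multiple : ∀ q r → r < ℕ.pred p → term (q ℕ.* p ℕ.+ suc r) ≡ + N′ * correlation (q ℕ.* p ℕ.+ suc r)
    term-non-multiple q r r<p-1 =
      trans (cong (sawℤ F a *_) (sawℤ-unit-orbit N′ f′ a (Coprimality.sym (coprime-^ʳ (prime∤⇒coprime p-prime p∤a) (suc e)))))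
            (swap (sawℤ F a) (+ N′) (sawℤ f′ a))
      where
      a : ℕ
      a = q ℕ.* p ℕ.+ suc r
      p∤a : ¬ p ∣ a
      p∤a p∣a = ℕₚ.<⇒≱ (subst (suc r <_) (ℕₚ.suc-pred p) (s≤s r<p-1)) (∣⇒≤ (∣m+n∣m⇒∣n p∣a (n∣m*n q)))
      swap : ∀ x n y → x * (n * y) ≡ n * (x * y)
      swap = solve-∀

    correlation-multiples : ΣZ M (λ q → correlation (q ℕ.* p)) ≡ + p * + p * (+ N′ * sawSquares h)
    correlation-multiples = begin
      ΣZ M (λ q → correlation (q ℕ.* p))                      ≡⟨ ΣZ-cong M (λ q _ → correlation-multiple q) ⟩
      ΣZ M (λ q → + p * + p * (sawℤ M q * sawℤ h q)) ≡⟨ ΣZ-*ˡ M (+ p * + p) _ ⟩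
      + p * + p * ΣZ M (λ q → sawℤ M q * sawℤ h q)   ≡⟨ cong (+ p * + p *_) (subst (λ m → ΣZ m (λ q → sawℤ m q * sawℤ h q) ≡ + N′ * sawSquares h)
                                                                                 (sym M≡N′h) (sawℤ-correlation N′ h)) ⟩
      + p * + p * (+ N′ * sawSquares h)               ∎
      where
      open ≡-Reasoning
      M≡N′h : M ≡ N′ ℕ.* h
      M≡N′h = trans (cong (N ℕ.*_) f′≡ph) (reassoc N p h)
        where
        reassoc : ∀ N p h → N ℕ.* (p ℕ.* h) ≡ p ℕ.* N ℕ.* h
        reassoc = ℕ-Solver.solve-∀
      collect : ∀ p x y → (p * x) * (p * y) ≡ p * p * (x * y)
      collect = solve-∀
      correlation-multiple : ∀ q → correlation (q ℕ.* p) ≡ + p * + p * (sawℤ M q * sawℤ h q)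
      correlation-multiple q = trans (cong correlation (ℕₚ.*-comm q p))
        (trans (cong₂ _*_ (scale q) (trans (cong (λ d → sawℤ d (p ℕ.* q)) f′≡ph) (sawℤ-scale p h q))) (collect (+ p) (sawℤ M q) (sawℤ h q)))

    F≡M*p : F ≡ M ℕ.* p
    F≡M*p = reassoc p N f′
      where
      reassoc : ∀ p N f′ → p ℕ.* N ℕ.* f′ ≡ N ℕ.* f′ ℕ.* p
      reassoc = ℕ-Solver.solve-∀

    correlation-non-multiples : ΣZ M (λ q → ΣZ (ℕ.pred p) (λ r → correlation (q ℕ.* p ℕ.+ suc r)))
                    ≡ + N′ * sawSquares f′ - + p * + p * (+ N′ * sawSquares h)
    correlation-non-multiples = trans (isolate (ΣZ M (λ q → correlation (q ℕ.* p))) _) (cong₂ _-_ total correlation-multiples)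
      where
      isolate : ∀ a x → x ≡ (a + x) - a
      isolate = solve-∀
      total : ΣZ M (λ q → correlation (q ℕ.* p)) + ΣZ M (λ q → ΣZ (ℕ.pred p) (λ r → correlation (q ℕ.* p ℕ.+ suc r))) ≡ + N′ * sawSquares f′
      total = trans (sym (ΣZ-split-multiples M p correlation)) (trans (cong (λ m → ΣZ m correlation) (sym F≡M*p)) (sawℤ-correlation N′ f′))

  Sℤ-step : ∀ e → Sℤ (p ^ suc e) f′ ≡ + p * + p * + p * Sℤ (p ^ e) f′
                                       + + (p ^ suc e) * (+ (p ^ suc e) * sawSquares f′ - + p * + p * (+ (p ^ suc e) * sawSquares h))
  Sℤ-step e = begin
    Sℤ N′ f′
      ≡⟨ Sℤ-by-residue N′ f′ ⟩
    ΣZ F term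
      ≡⟨ cong (λ m → ΣZ m term) F≡M*p ⟩
    ΣZ (M ℕ.* p) term
      ≡⟨ ΣZ-split-multiples M p term ⟩
    ΣZ M (λ q → term (q ℕ.* p)) + ΣZ M (λ q → ΣZ (ℕ.pred p) (λ r → term (q ℕ.* p ℕ.+ suc r)))
      ≡⟨ cong₂ _+_ (trans (ΣZ-cong M (λ q _ → term-multiple q)) (ΣZ-*ˡ M (+ p * + p * + p) _))
                   (trans (ΣZ-cong M (λ q _ → trans (ΣZ-cong (ℕ.pred p) (λ r r<p-1 → term-non-multiple q r r<p-1)) (ΣZ-*ˡ (ℕ.pred p) (+ N′) _)))
                          (ΣZ-*ˡ M (+ N′) _)) ⟩
    + p * + p * + p * ΣZ M (λ q → sawℤ M q * orbit N M q) + + N′ * ΣZ M (λ q → ΣZ (ℕ.pred p) (λ r → correlation (q ℕ.* p ℕ.+ suc r)))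
      ≡⟨ cong₂ (λ s y → + p * + p * + p * s + + N′ * y) (sym (Sℤ-by-residue N f′)) correlation-non-multiples ⟩
    + p * + p * + p * Sℤ N f′ + + N′ * (+ N′ * sawSquares f′ - + p * + p * (+ N′ * sawSquares h))
      ∎
    where
    open Step e
    open ≡-Reasoning

  Sℤ-closed : ∀ e → + 3 * Sℤ (p ^ e) f′ ≡ + (p ^ e) * + (p ^ e) * + f′ * S-numerator (+ (p ^ e)) (+ f′) (+ h)
  Sℤ-closed zero = begin
    + 3 * Sℤ 1 f′                                   ≡⟨ cong (+ 3 *_) (Sℤ-base f′) ⟩
    + 3 * sawSquares f′                             ≡⟨ sawSquares-closed f′ ⟩
    + f′ * (+ f′ - + 1) * (+ f′ - + 2)               ≡⟨ base (+ f′) (+ h) ⟩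
    + 1 * + 1 * + f′ * S-numerator (+ 1) (+ f′) (+ h) ∎
    where
    open ≡-Reasoning
    base : ∀ g h → g * (g - + 1) * (g - + 2) ≡ + 1 * + 1 * g * (+ 1 * g * g - + 3 * + 1 * g + + 1 * g * h - g * h + + 2)
    base = solve-∀
  Sℤ-closed (suc e) = begin
    + 3 * Sℤ (p ^ suc e) f′
      ≡⟨ cong (+ 3 *_) (Sℤ-step e) ⟩
    + 3 * (P * P * P * Sℤ (p ^ e) f′ + N′ * (N′ * sawSquares f′ - P * P * (N′ * sawSquares h)))
      ≡⟨ distribute P (Sℤ (p ^ e) f′) (sawSquares f′) (sawSquares h) N′ ⟩
    P * P * P * (+ 3 * Sℤ (p ^ e) f′) + N′ * (N′ * (+ 3 * sawSquares f′) - P * P * (N′ * (+ 3 * sawSquares h)))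
      ≡⟨ cong₃ (λ s b c → P * P * P * s + N′ * (N′ * b - P * P * (N′ * c))) (Sℤ-closed e) (sawSquares-closed f′) (sawSquares-closed h) ⟩
    P * P * P * (n * n * G * S-numerator n G H) + N′ * (N′ * (G * (G - + 1) * (G - + 2)) - P * P * (N′ * (H * (H - + 1) * (H - + 2))))
      ≡⟨ induction-step P n H G N′ (trans (cong +_ f′≡ph) (ℤₚ.pos-* p h)) (ℤₚ.pos-* p (p ^ e)) ⟩
    N′ * N′ * G * S-numerator N′ G H
      ∎
    where
    open ≡-Reasoning
    P n N′ G H : ℤ
    P = + p
    n = + (p ^ e)
    N′ = + (p ^ suc e)
    G = + f′
    H = + h
    distribute : ∀ P s b c N′ → + 3 * (P * P * P * s + N′ * (N′ * b - P * P * (N′ * c)))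
                              ≡ P * P * P * (+ 3 * s) + N′ * (N′ * (+ 3 * b) - P * P * (N′ * (+ 3 * c)))
    distribute = solve-∀
    induction-step : ∀ P n H G N′ → G ≡ P * H → N′ ≡ P * n →
      P * P * P * (n * n * G * S-numerator n G H) + N′ * (N′ * (G * (G - + 1) * (G - + 2)) - P * P * (N′ * (H * (H - + 1) * (H - + 2))))
      ≡ N′ * N′ * G * S-numerator N′ G H
    induction-step P n H _ _ refl refl = polynomial-identity P n H
      where
      polynomial-identity : ∀ P n H →
        P * P * P * (n * n * (P * H) * (n * (P * H) * (P * H) - + 3 * n * (P * H) + n * (P * H) * H - (P * H) * H + + 2))
          + (P * n) * ((P * n) * ((P * H) * ((P * H) - + 1) * ((P * H) - + 2)) - P * P * ((P * n) * (H * (H - + 1) * (H - + 2))))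
        ≡ (P * n) * (P * n) * (P * H)
          * ((P * n) * (P * H) * (P * H) - + 3 * (P * n) * (P * H) + (P * n) * (P * H) * H - (P * H) * H + + 2)
      polynomial-identity = solve-∀

module RationalBridge where

  open IntegerSums
  open Sawtooth
  open DedekindSums
  open import Data.Integer using (_+_; _*_; _-_; -_)
  open import Data.Rational.Unnormalised using (_/_)

  /-cross : ∀ a b D E .{{_ : NonZero D}} .{{_ : NonZero E}} → a * + E ≡ b * + D → a / D ≃ b / E
  /-cross a b (suc D) (suc E) eq = *≡* eq

  /-+ : ∀ a b D E .{{_ : NonZero D}} .{{_ : NonZero E}} → a / D ℚᵘ.+ b / E ≃ _/_ (a * + E + b * + D) (D ℕ.* E) {{ℕₚ.m*n≢0 D E}}
  /-+ a b (suc D) (suc E) = ℚᵘₚ.≃-refl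

  /-* : ∀ a b D E .{{_ : NonZero D}} .{{_ : NonZero E}} → (a / D) ℚᵘ.* (b / E) ≃ _/_ (a * b) (D ℕ.* E) {{ℕₚ.m*n≢0 D E}}
  /-* a b (suc D) (suc E) = ℚᵘₚ.≃-refl

  -‿/ : ∀ a D .{{_ : NonZero D}} → ℚᵘ.- (a / D) ≃ (- a) / D
  -‿/ a (suc D) = ℚᵘₚ.≃-refl

  /-+-same : ∀ a b D .{{_ : NonZero D}} → a / D ℚᵘ.+ b / D ≃ (a + b) / D
  /-+-same a b D = ℚᵘₚ.≃-trans (/-+ a b D D) (/-cross _ _ (D ℕ.* D) D {{ℕₚ.m*n≢0 D D}}
    (trans (factor a b (+ D)) (cong ((a + b) *_) (sym (ℤₚ.pos-* D D)))))
    where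
    factor : ∀ a b D → (a * D + b * D) * D ≡ (a + b) * (D * D)
    factor = solve-∀

  toℚᵘ-divQ : ∀ z D .{{_ : NonZero D}} → toℚᵘ (divQ z D) ≃ z / D
  toℚᵘ-divQ z (suc D) = ℚₚ.toℚᵘ-fromℚᵘ (z / suc D)

  toℚᵘ-homo-minus : ∀ x y → toℚᵘ (x ℚ.- y) ≃ toℚᵘ x ℚᵘ.- toℚᵘ y
  toℚᵘ-homo-minus x y = ℚᵘₚ.≃-trans (ℚₚ.toℚᵘ-homo-+ x (ℚ.- y)) (ℚᵘₚ.+-congʳ (toℚᵘ x) (ℚₚ.toℚᵘ-homo‿- y))

  toℚᵘ-[x-y]+z : ∀ a b c D₁ D₂ D₃ .{{_ : NonZero D₁}} .{{_ : NonZero D₂}} .{{_ : NonZero D₃}} .{{_ : NonZero (D₁ ℕ.* D₂ ℕ.* D₃)}} →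
                 toℚᵘ ((divQ a D₁ ℚ.- divQ b D₂) ℚ.+ divQ c D₃)
                 ≃ ((a * + D₂ + - b * + D₁) * + D₃ + c * + (D₁ ℕ.* D₂)) / (D₁ ℕ.* D₂ ℕ.* D₃)
  toℚᵘ-[x-y]+z a b c D₁@(suc _) D₂@(suc _) D₃@(suc _) = begin
    toℚᵘ ((divQ a D₁ ℚ.- divQ b D₂) ℚ.+ divQ c D₃)          ≈⟨ ℚₚ.toℚᵘ-homo-+ (divQ a D₁ ℚ.- divQ b D₂) (divQ c D₃) ⟩
    toℚᵘ (divQ a D₁ ℚ.- divQ b D₂) ℚᵘ.+ toℚᵘ (divQ c D₃)    ≈⟨ ℚᵘₚ.+-cong (toℚᵘ-homo-minus (divQ a D₁) (divQ b D₂)) (toℚᵘ-divQ c D₃) ⟩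
    (toℚᵘ (divQ a D₁) ℚᵘ.- toℚᵘ (divQ b D₂)) ℚᵘ.+ c / D₃    ≈⟨ ℚᵘₚ.+-congˡ (c / D₃) (ℚᵘₚ.+-cong (toℚᵘ-divQ a D₁) (ℚᵘₚ.-‿cong (toℚᵘ-divQ b D₂))) ⟩
    (a / D₁ ℚᵘ.- b / D₂) ℚᵘ.+ c / D₃                        ≈⟨ ℚᵘₚ.+-congˡ (c / D₃) (ℚᵘₚ.+-congʳ (a / D₁) (-‿/ b D₂)) ⟩
    (a / D₁ ℚᵘ.+ (- b) / D₂) ℚᵘ.+ c / D₃                    ≈⟨ ℚᵘₚ.+-congˡ (c / D₃) (/-+ a (- b) D₁ D₂) ⟩
    (a * + D₂ + - b * + D₁) / (D₁ ℕ.* D₂) ℚᵘ.+ c / D₃       ≈⟨ /-+ (a * + D₂ + - b * + D₁) c (D₁ ℕ.* D₂) D₃ ⟩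
    ((a * + D₂ + - b * + D₁) * + D₃ + c * + (D₁ ℕ.* D₂)) / (D₁ ℕ.* D₂ ℕ.* D₃) ∎
    where open ℚᵘₚ.≃-Reasoning

  toℚᵘ-ΣQ : ∀ n D .{{_ : NonZero D}} (g : ℕ → ℚ) (h : ℕ → ℤ) →
            (∀ i → i < n → toℚᵘ (g i) ≃ h i / D) → toℚᵘ (ΣQ n g) ≃ ΣZ n h / D
  toℚᵘ-ΣQ zero    D g h eq = /-cross (+ 0) (+ 0) 1 D refl
  toℚᵘ-ΣQ (suc n) D g h eq = begin
    toℚᵘ (ΣQ n g ℚ.+ g n)          ≈⟨ ℚₚ.toℚᵘ-homo-+ (ΣQ n g) (g n) ⟩
    toℚᵘ (ΣQ n g) ℚᵘ.+ toℚᵘ (g n)  ≈⟨ ℚᵘₚ.+-cong (toℚᵘ-ΣQ n D g h (λ i i<n → eq i (ℕₚ.m<n⇒m<1+n i<n))) (eq n ℕₚ.≤-refl) ⟩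
    ΣZ n h / D ℚᵘ.+ h n / D        ≈⟨ /-+-same (ΣZ n h) (h n) D ⟩
    ΣZ (suc n) h / D               ∎
    where open ℚᵘₚ.≃-Reasoning

  saw-bridge : ∀ a d .{{_ : NonZero d}} → toℚᵘ (saw a d) ≃ _/_ (sawℤ d a) (2 ℕ.* d) {{ℕₚ.m*n≢0 2 d}}
  saw-bridge a (suc d) with a % suc d ℕ.≟ 0
  ... | yes r≡0 = /-cross (+ 0) _ 1 (2 ℕ.* suc d) (cong (λ r → sawʳ (suc d) r * + 1) (sym r≡0))
  ... | no  r≢0 = begin
    toℚᵘ (divQ (+ r) (suc d) ℚ.- divQ (+ 1) 2)                ≈⟨ toℚᵘ-homo-minus (divQ (+ r) (suc d)) (divQ (+ 1) 2) ⟩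
    toℚᵘ (divQ (+ r) (suc d)) ℚᵘ.- toℚᵘ (divQ (+ 1) 2)        ≈⟨ ℚᵘₚ.+-cong (toℚᵘ-divQ (+ r) (suc d)) (ℚᵘₚ.-‿cong (toℚᵘ-divQ (+ 1) 2)) ⟩
    + r / suc d ℚᵘ.- + 1 / 2                                  ≈⟨ ℚᵘₚ.+-congʳ (+ r / suc d) (-‿/ (+ 1) 2) ⟩
    + r / suc d ℚᵘ.+ (- + 1) / 2                              ≈⟨ /-+ (+ r) (- + 1) (suc d) 2 ⟩
    (+ r * + 2 + - + 1 * + suc d) / (suc d ℕ.* 2)             ≈⟨ /-cross _ _ (suc d ℕ.* 2) (2 ℕ.* suc d) cross ⟩
    sawʳ (suc d) r / (2 ℕ.* suc d)                            ∎
    where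
    open ℚᵘₚ.≃-Reasoning
    r : ℕ
    r = a % suc d
    sawʳ-≢0 : ∀ {d r} → r ≢ 0 → sawʳ d r ≡ + 2 * + r - + d
    sawʳ-≢0 {r = zero}  r≢0 = contradiction refl r≢0
    sawʳ-≢0 {d} {suc r} _   = cong (_- + d) (ℤₚ.pos-* 2 (suc r))
    rearrange : ∀ r d → (r * + 2 + - + 1 * d) * (+ 2 * d) ≡ (+ 2 * r - d) * (d * + 2)
    rearrange = solve-∀
    cross : (+ r * + 2 + - + 1 * + suc d) * + (2 ℕ.* suc d) ≡ sawʳ (suc d) r * + (suc d ℕ.* 2)
    cross = trans (cong ((+ r * + 2 + - + 1 * + suc d) *_) (ℤₚ.pos-* 2 (suc d))) (trans (rearrange (+ r) (+ suc d))
              (cong₂ _*_ (sym (sawʳ-≢0 r≢0)) (sym (ℤₚ.pos-* (suc d) 2))))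

  dedekind-bridge : ∀ c d .{{_ : NonZero d}} .{{_ : NonZero (2 ℕ.* d ℕ.* (2 ℕ.* d))}} →
                    toℚᵘ (dedekind c d) ≃ dedekindℤ c d / (2 ℕ.* d ℕ.* (2 ℕ.* d))
  dedekind-bridge c d@(suc d₀) = ℚᵘₚ.≃-trans (toℚᵘ-ΣQ d₀ D _ (λ i → sawℤ d (suc i) * sawℤ d (suc i ℕ.* c)) (λ i _ → term i))
                                             (ℚᵘₚ.≃-reflexive (cong (_/ D) (sym (trans (ΣZ-head d₀ _) (ℤₚ.+-identityˡ _)))))
    where
    D : ℕ
    D = 2 ℕ.* d ℕ.* (2 ℕ.* d)
    term : ∀ i → toℚᵘ (saw (suc i) d ℚ.* saw (suc i ℕ.* c) d) ≃ (sawℤ d (suc i) * sawℤ d (suc i ℕ.* c)) / D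
    term i = ℚᵘₚ.≃-trans (ℚₚ.toℚᵘ-homo-* (saw (suc i) d) (saw (suc i ℕ.* c) d))
               (ℚᵘₚ.≃-trans (ℚᵘₚ.*-cong (saw-bridge (suc i) d) (saw-bridge (suc i ℕ.* c) d))
                            (/-* (sawℤ d (suc i)) (sawℤ d (suc i ℕ.* c)) (2 ℕ.* d) (2 ℕ.* d)))

module SmallModuli where

  open import Data.Nat using (_+_; _*_; _/_)
  open CoprimeProducts

  2∤1+2* : ∀ k → ¬ 2 ∣ 1 + 2 * k
  2∤1+2* k 2∣ = contradiction (∣1⇒≡1 (∣m+n∣m⇒∣n (subst (2 ∣_) (ℕₚ.+-comm 1 (2 * k)) 2∣) (m∣m*n k))) (λ ())

  even-or-odd : ∀ n → ∃ λ k → n ≡ 2 * k ⊎ n ≡ 1 + 2 * k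
  even-or-odd n with n % 2 in eq | m%n<n n 2
  ... | 0           | _               = n / 2 , inj₁ (trans (m≡m%n+[m/n]*n n 2) (cong₂ _+_ eq (ℕₚ.*-comm (n / 2) 2)))
  ... | 1           | _               = n / 2 , inj₂ (trans (m≡m%n+[m/n]*n n 2) (cong₂ _+_ eq (ℕₚ.*-comm (n / 2) 2)))
  ... | suc (suc _) | s≤s (s≤s ())

  2∤⇒1+2* : ∀ {n} → ¬ 2 ∣ n → ∃ λ k → n ≡ 1 + 2 * k
  2∤⇒1+2* {n} 2∤n with even-or-odd n
  ... | k , inj₁ n≡2k   = contradiction (divides k (trans n≡2k (ℕₚ.*-comm 2 k))) 2∤n
  ... | k , inj₂ n≡1+2k = k , n≡1+2k

  -- both sides say that s is even
  odd[1+s+2k]⇔[3+2s]%4≡3 : ∀ s k → (¬ 2 ∣ 1 + s + 2 * k) ⇔ (3 + 2 * s) % 4 ≡ 3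
  odd[1+s+2k]⇔[3+2s]%4≡3 s k with even-or-odd s
  ... | m , inj₁ refl = mk⇔ (λ _ → trans (cong (_% 4) (regroup₁ m)) ([m+kn]%n≡m%n 3 m 4))
                            (λ _ → 2∤1+2* (m + k) ∘ subst (2 ∣_) (regroup₂ m k))
    where
    regroup₁ : ∀ m → 3 + 2 * (2 * m) ≡ 3 + m * 4
    regroup₁ = ℕ-Solver.solve-∀
    regroup₂ : ∀ m k → 1 + 2 * m + 2 * k ≡ 1 + 2 * (m + k)
    regroup₂ = ℕ-Solver.solve-∀
  ... | m , inj₂ refl = mk⇔ (λ odd → contradiction (divides (1 + m + k) (regroup₂ m k)) odd)
                            (λ ≡3 → contradiction (trans (sym (trans (cong (_% 4) (regroup₁ m)) ([m+kn]%n≡m%n 1 (1 + m) 4))) ≡3) (λ ()))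
    where
    regroup₁ : ∀ m → 3 + 2 * (1 + 2 * m) ≡ 1 + (1 + m) * 4
    regroup₁ = ℕ-Solver.solve-∀
    regroup₂ : ∀ m k → 1 + (1 + 2 * m) + 2 * k ≡ (1 + m + k) * 2
    regroup₂ = ℕ-Solver.solve-∀

  3∤⇒square≡1+3* : ∀ {x} → ¬ 3 ∣ x → ∃ λ w → x * x ≡ 1 + 3 * w
  3∤⇒square≡1+3* {x} 3∤x = (x * x) / 3 , trans (m≡m%n+[m/n]*n (x * x) 3) (cong₂ _+_ square%3 (ℕₚ.*-comm ((x * x) / 3) 3))
    where
    unit-square : ∀ r → r < 3 → r ≢ 0 → (r * r) % 3 ≡ 1
    unit-square 0 _ r≢0 = contradiction refl r≢0
    unit-square 1 _ _   = refl
    unit-square 2 _ _   = refl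
    unit-square (suc (suc (suc _))) (s≤s (s≤s (s≤s ())))
    square%3 : (x * x) % 3 ≡ 1
    square%3 = trans (%-distribˡ-* x x 3) (unit-square (x % 3) (m%n<n x 3) (3∤x ∘ m%n≡0⇒n∣m x 3))

  3∣[p^n+2]*[p+1] : ∀ {p} → ¬ 3 ∣ p → ∀ n → 3 ∣ (p ^ n + 2) * (p + 1)
  3∣[p^n+2]*[p+1] {p} 3∤p n with p % 3 in eq | m%n<n p 3
  ... | 0 | _ = contradiction (m%n≡0⇒n∣m p 3 eq) 3∤p
  ... | 1 | _ = ∣m⇒∣m*n (p + 1) (m%n≡0⇒n∣m (p ^ n + 2) 3 (trans (%-distribˡ-+ (p ^ n) 2 3) (cong (λ r → (r + 2) % 3) (p^n%3 n))))
    where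
    p^n%3 : ∀ n → p ^ n % 3 ≡ 1
    p^n%3 zero    = refl
    p^n%3 (suc n) = trans (%-distribˡ-* p (p ^ n) 3) (cong₂ (λ r s → (r * s) % 3) eq (p^n%3 n))
  ... | 2 | _ = ∣n⇒∣m*n (p ^ n + 2) (m%n≡0⇒n∣m (p + 1) 3 (trans (%-distribˡ-+ p 1 3) (cong (λ r → (r + 1) % 3) eq)))
  ... | suc (suc (suc _)) | s≤s (s≤s (s≤s ()))

  odd>1⇒3+2* : ∀ {m} → 1 < m → ¬ 2 ∣ m → ∃ λ a → m ≡ 3 + 2 * a
  odd>1⇒3+2* 1<m 2∤m with 2∤⇒1+2* 2∤m
  ... | zero  , refl    = contradiction 1<m (λ { (s≤s ()) })
  ... | suc a , m≡1+2k = a , trans m≡1+2k (shift a)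
    where
    shift : ∀ a → 1 + 2 * suc a ≡ 3 + 2 * a
    shift = ℕ-Solver.solve-∀

  odd-prime-power : ∀ {p} → Prime p → 3 ≤ p → ∀ n → ∃ λ b → p ^ n ≡ 1 + 2 * b
  odd-prime-power {p} p-prime 3≤p n = 2∤⇒1+2* λ 2∣p^n → contradiction (2⊥p^n (∣-refl , 2∣p^n)) (λ ())
    where
    2∤p : ¬ 2 ∣ p
    2∤p 2∣p with prime⇒irreducible p-prime 2∣p
    ... | inj₁ ()
    ... | inj₂ refl = contradiction 3≤p (λ { (s≤s (s≤s ())) })
    2⊥p^n : Coprime 2 (p ^ n)
    2⊥p^n = coprime-^ʳ (Coprimality.sym (prime∤⇒coprime prime[2] 2∤p)) n

  gcd[3,m] : ∀ m → (3 ∣ m × gcd 3 m ≡ 3) ⊎ (¬ 3 ∣ m × gcd 3 m ≡ 1)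
  gcd[3,m] m with 3 ∣? m
  ... | yes 3∣m = inj₁ (3∣m , ∣-antisym (gcd[m,n]∣m 3 m) (gcd-greatest ∣-refl 3∣m))
  ... | no  3∤m with prime⇒irreducible (from-yes (prime? 3)) (gcd[m,n]∣m 3 m)
  ...   | inj₁ gcd≡1 = inj₂ (3∤m , gcd≡1)
  ...   | inj₂ gcd≡3 = contradiction (subst (_∣ m) gcd≡3 (gcd[m,n]∣n 3 m)) 3∤m

  third-of-gcd[3,m]* : ∀ m {U} → (¬ 3 ∣ m → 3 ∣ U) → ∃ λ u → gcd 3 m * U ≡ 3 * u × (U ≡ u ⊎ U ≡ 3 * u)
  third-of-gcd[3,m]* m {U} 3∣U with gcd[3,m] m
  ... | inj₁ (_   , gcd≡3) = U , cong (_* U) gcd≡3 , inj₁ refl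
  ... | inj₂ (3∤m , gcd≡1) with 3∣U 3∤m
  ...   | divides u U≡u*3 = u , trans (cong (_* U) gcd≡1) (trans (ℕₚ.*-identityˡ U) U≡3u) , inj₂ U≡3u
    where
    U≡3u : U ≡ 3 * u
    U≡3u = trans U≡u*3 (ℕₚ.*-comm u 3)

  ∣-third : ∀ {d u U} → (U ≡ u ⊎ U ≡ 3 * u) → d ∣ u → d ∣ U
  ∣-third (inj₁ refl) d∣u = d∣u
  ∣-third (inj₂ refl) d∣u = ∣n⇒∣m*n 3 d∣u

  2∣-third : ∀ {u U} → (U ≡ u ⊎ U ≡ 3 * u) → 2 ∣ U → 2 ∣ u
  2∣-third (inj₁ refl) 2∣U = 2∣U
  2∣-third {u} (inj₂ refl) 2∣3u = ∣m+n∣m⇒∣n (subst (2 ∣_) (split u) 2∣3u) (m∣m*n u)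
    where
    split : ∀ u → 3 * u ≡ 2 * u + u
    split = ℕ-Solver.solve-∀

module HalfNumerator {N f′ h a b : ℕ} (N≡1+2b : N ≡ 1 ℕ.+ 2 ℕ.* b) (f′≡3+2a : f′ ≡ 3 ℕ.+ 2 ℕ.* a) where

  open import Data.Nat using (_+_; _*_)
  open SmallModuli

  -- 2U = S-numerator N f′ h (Formula.V≡2U)
  U : ℕ
  U = f′ * (N * a + b * h) + 1

  divisor-of-f′-and-U : ∀ {d} → d ∣ f′ → d ∣ U → d ≡ 1
  divisor-of-f′-and-U d∣f′ d∣U = ∣1⇒≡1 (∣m+n∣m⇒∣n d∣U (∣m⇒∣m*n (N * a + b * h) d∣f′))

  U-odd⇔f%4≡3 : ¬ 2 ∣ h → (¬ 2 ∣ U) ⇔ (N * f′) % 4 ≡ 3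
  U-odd⇔f%4≡3 2∤h with 2∤⇒1+2* 2∤h
  ... | c , refl = subst₂ (λ x y → (¬ 2 ∣ x) ⇔ y ≡ 3) (sym U≡1+[a+b]+2K) (sym f%4) (odd[1+s+2k]⇔[3+2s]%4≡3 (a + b) K)
    where
    K : ℕ
    K = a + b + 4 * a * b + 3 * b * c + a * a + 2 * a * a * b + 2 * a * b * c
    expandU : ∀ a b c → (3 + 2 * a) * ((1 + 2 * b) * a + b * (1 + 2 * c)) + 1
                      ≡ 1 + (a + b) + 2 * (a + b + 4 * a * b + 3 * b * c + a * a + 2 * a * a * b + 2 * a * b * c)
    expandU = ℕ-Solver.solve-∀
    U≡1+[a+b]+2K : U ≡ 1 + (a + b) + 2 * K
    U≡1+[a+b]+2K = trans (cong₂ (λ x y → x * (y * a + b * (1 + 2 * c)) + 1) f′≡3+2a N≡1+2b) (expandU a b c)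
    expandf : ∀ a b → (1 + 2 * b) * (3 + 2 * a) ≡ 3 + 2 * (a + b) + (a * b + b) * 4
    expandf = ℕ-Solver.solve-∀
    f%4 : (N * f′) % 4 ≡ (3 + 2 * (a + b)) % 4
    f%4 = trans (cong (_% 4) (trans (cong₂ _*_ N≡1+2b f′≡3+2a) (expandf a b))) ([m+kn]%n≡m%n (3 + 2 * (a + b)) (a * b + b) 4)

  -- 2U + 3(N f′ + f′ h) ≡ (N + 2)(p + 1) (mod 3) once p² ≡ h² ≡ 1, and p ≡ 1 forces N = p^n ≡ 1
  3∣U : ∀ {p n} → N ≡ p ^ n → f′ ≡ p * h → ¬ 3 ∣ N * f′ → 3 ∣ U
  3∣U {p} {n} N≡p^n f′≡ph 3∤f = ∣m+n∣m⇒∣n (subst (3 ∣_) (sym (2U+U≡3U U)) (m∣m*n U)) 3∣2U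
    where
    2U+U≡3U : ∀ U → 2 * U + U ≡ 3 * U
    2U+U≡3U = ℕ-Solver.solve-∀
    3∤p : ¬ 3 ∣ p
    3∤p 3∣p = 3∤f (∣n⇒∣m*n N (subst (3 ∣_) (sym f′≡ph) (∣m⇒∣m*n h 3∣p)))
    3∤h : ¬ 3 ∣ h
    3∤h 3∣h = 3∤f (∣n⇒∣m*n N (subst (3 ∣_) (sym f′≡ph) (∣n⇒∣m*n p 3∣h)))
    Q : ℕ
    Q = N * f′ * f′ + N * f′ * h + 2 * f′ * h + 2
    Q≡3[…]+2U : Q ≡ 3 * (N * f′ + f′ * h) + 2 * U
    Q≡3[…]+2U = trans (cong₂ (λ x y → y * x * x + y * x * h + 2 * x * h + 2) f′≡3+2a N≡1+2b)
                      (trans (expand a b h) (sym (cong₂ (λ x y → 3 * (y * x + x * h) + 2 * (x * (y * a + b * h) + 1)) f′≡3+2a N≡1+2b)))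
      where
      expand : ∀ a b h → (1 + 2 * b) * (3 + 2 * a) * (3 + 2 * a) + (1 + 2 * b) * (3 + 2 * a) * h + 2 * (3 + 2 * a) * h + 2
                       ≡ 3 * ((1 + 2 * b) * (3 + 2 * a) + (3 + 2 * a) * h) + 2 * ((3 + 2 * a) * ((1 + 2 * b) * a + b * h) + 1)
      expand = ℕ-Solver.solve-∀
    3∣Q : 3 ∣ Q
    3∣Q with 3∤⇒square≡1+3* 3∤p | 3∤⇒square≡1+3* 3∤h
    ... | v , p²≡1+3v | w , h²≡1+3w = subst (3 ∣_) (sym Q≡) (∣m∣n⇒∣m+n 3∣[N+2][p+1] (m∣m*n X))
      where
      X : ℕ
      X = w * (N * (1 + 3 * v) + N * p + 2 * p) + v * N
      3∣[N+2][p+1] : 3 ∣ (N + 2) * (p + 1)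
      3∣[N+2][p+1] = subst (λ x → 3 ∣ (x + 2) * (p + 1)) (sym N≡p^n) (3∣[p^n+2]*[p+1] 3∤p n)
      factor : ∀ N p h → N * (p * h) * (p * h) + N * (p * h) * h + 2 * (p * h) * h + 2 ≡ (h * h) * (N * (p * p) + N * p + 2 * p) + 2
      factor = ℕ-Solver.solve-∀
      reduce : ∀ N p v w → (1 + 3 * w) * (N * (1 + 3 * v) + N * p + 2 * p) + 2
                         ≡ (N + 2) * (p + 1) + 3 * (w * (N * (1 + 3 * v) + N * p + 2 * p) + v * N)
      reduce = ℕ-Solver.solve-∀
      Q≡ : Q ≡ (N + 2) * (p + 1) + 3 * X
      Q≡ = trans (cong (λ x → N * x * x + N * x * h + 2 * x * h + 2) f′≡ph)
                 (trans (factor N p h) (trans (cong₂ (λ s t → s * (N * t + N * p + 2 * p) + 2) h²≡1+3w p²≡1+3v) (reduce N p v w)))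
    3∣2U : 3 ∣ 2 * U
    3∣2U = ∣m+n∣m⇒∣n (subst (3 ∣_) Q≡3[…]+2U 3∣Q) (m∣m*n (N * f′ + f′ * h))

module KernelAndTrace where

  open import Data.Nat using (_+_; _*_; _/_)
  open CoprimeProducts

  1+k*f′-coprime : ∀ k f′ → Coprime (1 + k * f′) f′
  1+k*f′-coprime k f′ {d} (d∣x , d∣f′) = ∣1⇒≡1 (∣m+n∣m⇒∣n (subst (d ∣_) (ℕₚ.+-comm 1 (k * f′)) d∣x) (∣n⇒∣m*n k d∣f′))

  kernel-characterisation : ∀ {p f′} → p ∣ f′ → ∀ n x → x < p ^ n * f′ →
    (Coprime x (p ^ n * f′) × (∃ λ q → x ≡ 1 + q * f′)) ⇔ (∃ λ k → k < p ^ n × x ≡ 1 + k * f′)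
  kernel-characterisation {p} {f′} p∣f′ n x x<f = mk⇔ to from
    where
    to : Coprime x (p ^ n * f′) × (∃ λ q → x ≡ 1 + q * f′) → ∃ λ k → k < p ^ n × x ≡ 1 + k * f′
    to (_ , q , x≡) = q , ℕₚ.*-cancelʳ-< f′ q (p ^ n) (ℕₚ.<-trans (ℕₚ.n<1+n (q * f′)) (subst (_< p ^ n * f′) x≡ x<f)) , x≡
    from : (∃ λ k → k < p ^ n × x ≡ 1 + k * f′) → Coprime x (p ^ n * f′) × (∃ λ q → x ≡ 1 + q * f′)
    from (k , _ , x≡) = subst (λ y → Coprime y (p ^ n * f′)) (sym x≡) (coprime-*ʳ (coprime-^ʳ x⊥p n) x⊥f′) , k , x≡
      where
      x⊥f′ : Coprime (1 + k * f′) f′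
      x⊥f′ = 1+k*f′-coprime k f′
      x⊥p : Coprime (1 + k * f′) p
      x⊥p = coprime-∣ʳ x⊥f′ p∣f′

  -- stated with both sides moved so that no subtraction occurs
  ΣN-arithmetic : ∀ m c → 2 * ΣN m (λ k → 1 + k * c) + c * m ≡ 2 * m + c * m * m
  ΣN-arithmetic zero    c = trans (ℕₚ.*-zeroʳ c) (sym (ℕₚ.*-zeroʳ (c * 0)))
  ΣN-arithmetic (suc m) c = begin
    2 * (ΣN m (λ k → 1 + k * c) + (1 + m * c)) + c * suc m    ≡⟨ split (ΣN m (λ k → 1 + k * c)) m c ⟩
    (2 * ΣN m (λ k → 1 + k * c) + c * m) + (2 + 2 * m * c + c) ≡⟨ cong (_+ (2 + 2 * m * c + c)) (ΣN-arithmetic m c) ⟩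
    2 * m + c * m * m + (2 + 2 * m * c + c)                   ≡⟨ merge m c ⟩
    2 * suc m + c * suc m * suc m                             ∎
    where
    open ≡-Reasoning
    split : ∀ S m c → 2 * (S + (1 + m * c)) + c * suc m ≡ (2 * S + c * m) + (2 + 2 * m * c + c)
    split = ℕ-Solver.solve-∀
    merge : ∀ m c → 2 * m + c * m * m + (2 + 2 * m * c + c) ≡ 2 * suc m + c * suc m * suc m
    merge = ℕ-Solver.solve-∀

  module _ {N f′ b : ℕ} (N≡1+2b : N ≡ 1 + 2 * b) where

    T≡N+bf : ΣN N (λ k → 1 + k * f′) ≡ N + b * (N * f′)
    T≡N+bf = ℕₚ.*-cancelˡ-≡ _ _ 2 (ℕₚ.+-cancelʳ-≡ (f′ * N) _ _ (trans (ΣN-arithmetic N f′)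
               (trans (cong (λ x → 2 * x + f′ * x * x) N≡1+2b)
                      (trans (expand b f′) (cong (λ x → 2 * (x + b * (x * f′)) + f′ * x) (sym N≡1+2b))))))
      where
      expand : ∀ b f′ → 2 * (1 + 2 * b) + f′ * (1 + 2 * b) * (1 + 2 * b) ≡ 2 * ((1 + 2 * b) + b * ((1 + 2 * b) * f′)) + f′ * (1 + 2 * b)
      expand = ℕ-Solver.solve-∀

    T-formula : ΣN N (λ k → 1 + k * f′) ≡ N + ((N ∸ 1) / 2) * (N * f′)
    T-formula = trans T≡N+bf (cong (λ x → N + x * (N * f′)) (sym [N∸1]/2≡b))
      where
      [N∸1]/2≡b : (N ∸ 1) / 2 ≡ b
      [N∸1]/2≡b = trans (cong (λ x → (x ∸ 1) / 2) N≡1+2b) (trans (cong (_/ 2) (ℕₚ.*-comm 2 b)) (m*n/n≡m b 2))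

    gcd[f,T]≡N : gcd (N * f′) (ΣN N (λ k → 1 + k * f′)) ≡ N
    gcd[f,T]≡N = ∣-antisym gcd∣N N∣gcd
      where
      T : ℕ
      T = ΣN N (λ k → 1 + k * f′)
      gcd∣N : gcd (N * f′) T ∣ N
      gcd∣N = ∣m+n∣m⇒∣n (subst (gcd (N * f′) T ∣_) (trans T≡N+bf (ℕₚ.+-comm N _)) (gcd[m,n]∣n (N * f′) T))
                        (∣n⇒∣m*n b (gcd[m,n]∣m (N * f′) T))
      N∣gcd : N ∣ gcd (N * f′) T
      N∣gcd = gcd-greatest (m∣m*n f′) (subst (N ∣_) (sym T≡N+bf) (∣m∣n⇒∣m+n ∣-refl (∣n⇒∣m*n b (m∣m*n f′))))

module Formula {p f′ h n a b : ℕ} (p-prime : Prime p) (f′≡ph : f′ ≡ p ℕ.* h) .{{_ : NonZero h}}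
               (N≡1+2b : p ^ n ≡ 1 ℕ.+ 2 ℕ.* b) (f′≡3+2a : f′ ≡ 3 ℕ.+ 2 ℕ.* a) where

  open IntegerSums
  open DedekindSums
  open RationalBridge
  open SmallModuli
  open Recursion p-prime f′≡ph
  open HalfNumerator {h = h} {a = a} {b = b} N≡1+2b f′≡3+2a
  open import Data.Integer using (_+_; _*_; _-_; -_)
  open import Data.Rational.Unnormalised using (_/_)

  N f : ℕ
  N = p ^ n
  f = N ℕ.* f′

  instance
    N≢0 : NonZero N
    N≢0 = ℕₚ.m^n≢0 p n
    f≢0 : NonZero f
    f≢0 = ℕₚ.m*n≢0 N f′
    12f′≢0 : NonZero (12 ℕ.* f′)
    12f′≢0 = ℕₚ.m*n≢0 12 f′
    [2f]²≢0 : NonZero (2 ℕ.* f ℕ.* (2 ℕ.* f))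
    [2f]²≢0 = ℕₚ.m*n≢0 (2 ℕ.* f) (2 ℕ.* f) {{ℕₚ.m*n≢0 2 f}} {{ℕₚ.m*n≢0 2 f}}

  V : ℤ
  V = S-numerator (+ N) (+ f′) (+ h)

  S : ℚ
  S = ΣQ N (λ k → dedekind (1 ℕ.+ k ℕ.* f′) f)

  N-cast : + N ≡ + 2 * + b + + 1
  N-cast = trans (cong +_ (trans N≡1+2b (ℕₚ.+-comm 1 (2 ℕ.* b)))) (trans (ℤₚ.pos-+ (2 ℕ.* b) 1) (cong (_+ + 1) (ℤₚ.pos-* 2 b)))

  f′-cast : + f′ ≡ + 2 * + a + + 3
  f′-cast = trans (cong +_ (trans f′≡3+2a (ℕₚ.+-comm 3 (2 ℕ.* a)))) (trans (ℤₚ.pos-+ (2 ℕ.* a) 3) (cong (_+ + 3) (ℤₚ.pos-* 2 a)))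

  U-cast : + U ≡ + f′ * (+ N * + a + + b * + h) + + 1
  U-cast = trans (ℤₚ.pos-+ (f′ ℕ.* (N ℕ.* a ℕ.+ b ℕ.* h)) 1) (cong (_+ + 1) (trans (ℤₚ.pos-* f′ _)
         (cong (+ f′ *_) (trans (ℤₚ.pos-+ (N ℕ.* a) (b ℕ.* h)) (cong₂ _+_ (ℤₚ.pos-* N a) (ℤₚ.pos-* b h))))))

  V≡2U : V ≡ + 2 * + U
  V≡2U = trans (cong₂ (λ x y → S-numerator x y (+ h)) N-cast f′-cast) (trans (halve (+ a) (+ b) (+ h))
           (sym (cong (+ 2 *_) (trans U-cast (cong₂ (λ x y → y * (x * + a + + b * + h) + + 1) N-cast f′-cast)))))
    where
    halve : ∀ a b h → (+ 2 * b + + 1) * (+ 2 * a + + 3) * (+ 2 * a + + 3) - + 3 * (+ 2 * b + + 1) * (+ 2 * a + + 3)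
                      + (+ 2 * b + + 1) * (+ 2 * a + + 3) * h - (+ 2 * a + + 3) * h + + 2
                    ≡ + 2 * ((+ 2 * a + + 3) * ((+ 2 * b + + 1) * a + b * h) + + 1)
    halve = solve-∀

  S≃V/12f′ : toℚᵘ S ≃ V / (12 ℕ.* f′)
  S≃V/12f′ = ℚᵘₚ.≃-trans (toℚᵘ-ΣQ N (2 ℕ.* f ℕ.* (2 ℕ.* f)) _ (λ k → dedekindℤ (1 ℕ.+ k ℕ.* f′) f)
                                  (λ k _ → dedekind-bridge (1 ℕ.+ k ℕ.* f′) f))
                         (/-cross (Sℤ N f′) V (2 ℕ.* f ℕ.* (2 ℕ.* f)) (12 ℕ.* f′) (ℤₚ.*-cancelˡ-≡ (+ 3) _ _ (begin
    + 3 * (Sℤ N f′ * + (12 ℕ.* f′))                          ≡⟨ sym (ℤₚ.*-assoc (+ 3) (Sℤ N f′) _) ⟩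
    + 3 * Sℤ N f′ * + (12 ℕ.* f′)                            ≡⟨ cong₂ _*_ (Sℤ-closed n) (ℤₚ.pos-* 12 f′) ⟩
    + N * + N * + f′ * V * (+ 12 * + f′)                      ≡⟨ rearrange (+ N) (+ f′) V ⟩
    + 3 * (V * ((+ 2 * (+ N * + f′)) * (+ 2 * (+ N * + f′))))  ≡⟨ cong (λ x → + 3 * (V * x)) (sym [2f]²≡) ⟩
    + 3 * (V * + (2 ℕ.* f ℕ.* (2 ℕ.* f)))                     ∎)))
    where
    open ≡-Reasoning
    rearrange : ∀ N g V → N * N * g * V * (+ 12 * g) ≡ + 3 * (V * ((+ 2 * (N * g)) * (+ 2 * (N * g))))
    rearrange = solve-∀
    2f≡ : + (2 ℕ.* f) ≡ + 2 * (+ N * + f′)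
    2f≡ = trans (ℤₚ.pos-* 2 f) (cong (+ 2 *_) (ℤₚ.pos-* N f′))
    [2f]²≡ : + (2 ℕ.* f ℕ.* (2 ℕ.* f)) ≡ (+ 2 * (+ N * + f′)) * (+ 2 * (+ N * + f′))
    [2f]²≡ = trans (ℤₚ.pos-* (2 ℕ.* f) (2 ℕ.* f)) (cong₂ _*_ 2f≡ 2f≡)

  A D₁ : ℕ
  A = (p ^ suc n ℕ.+ p ^ n ∸ 1) ℕ.* f
  D₁ = 12 ℕ.* p ^ suc n

  instance
    D₁≢0 : NonZero D₁
    D₁≢0 = ℕₚ.m*n≢0 12 (p ^ suc n) {{_}} {{ℕₚ.m^n≢0 p (suc n)}}
    6f≢0 : NonZero (6 ℕ.* f)
    6f≢0 = ℕₚ.m*n≢0 6 f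
    D₁4·6f≢0 : NonZero (D₁ ℕ.* 4 ℕ.* (6 ℕ.* f))
    D₁4·6f≢0 = ℕₚ.m*n≢0 (D₁ ℕ.* 4) (6 ℕ.* f) {{ℕₚ.m*n≢0 D₁ 4}}

  paper-formula : ℚ
  paper-formula = (divQ (+ A) D₁ ℚ.- divQ (+ N) 4) ℚ.+ divQ (+ N) (6 ℕ.* f)

  A≡ : + A ≡ (+ p * + N + + N - + 1) * (+ N * + f′)
  A≡ = trans (ℤₚ.pos-* (p ^ suc n ℕ.+ N ∸ 1) f) (cong₂ _*_ pN+N∸1≡ (ℤₚ.pos-* N f′))
    where
    1≤pN+N : 1 ≤ p ^ suc n ℕ.+ N
    1≤pN+N = ℕₚ.≤-trans (subst (1 ≤_) (sym N≡1+2b) (s≤s z≤n)) (ℕₚ.m≤n+m N (p ^ suc n))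
    pN+N∸1≡ : + (p ^ suc n ℕ.+ N ∸ 1) ≡ + p * + N + + N - + 1
    pN+N∸1≡ = trans (sym (ℤₚ.⊖-≥ 1≤pN+N)) (trans (sym (ℤₚ.m-n≡m⊖n (p ^ suc n ℕ.+ N) 1))
                (cong (_- + 1) (trans (ℤₚ.pos-+ (p ^ suc n) N) (cong (_+ + N) (ℤₚ.pos-* p N)))))

  paper-formula-cross : ((+ A * + 4 + - + N * + D₁) * + (6 ℕ.* f) + + N * + (D₁ ℕ.* 4)) * + (12 ℕ.* f′)
                      ≡ V * + (D₁ ℕ.* 4 ℕ.* (6 ℕ.* f))
  paper-formula-cross = begin
    ((+ A * + 4 + - + N * + D₁) * + (6 ℕ.* f) + + N * + (D₁ ℕ.* 4)) * + (12 ℕ.* f′)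
      ≡⟨ cong₃ (λ x y z → ((+ A * + 4 + - + N * + D₁) * x + + N * y) * z) (ℤₚ.pos-* 6 f) (ℤₚ.pos-* D₁ 4) (ℤₚ.pos-* 12 f′) ⟩
    ((+ A * + 4 + - + N * + D₁) * (+ 6 * + f) + + N * (+ D₁ * + 4)) * (+ 12 * + f′)
      ≡⟨ common-denominator (+ p) (+ N) (+ h) (+ A) (+ D₁) (+ f) (+ f′) f′≡ph′ (ℤₚ.pos-* N f′)
                            (trans A≡ (cong ((+ p * + N + + N - + 1) *_) (sym (ℤₚ.pos-* N f′)))) D₁≡ ⟩
    V * ((+ D₁ * + 4) * (+ 6 * + f))
      ≡⟨ cong (V *_) (sym (trans (ℤₚ.pos-* (D₁ ℕ.* 4) (6 ℕ.* f)) (cong₂ _*_ (ℤₚ.pos-* D₁ 4) (ℤₚ.pos-* 6 f)))) ⟩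
    V * + (D₁ ℕ.* 4 ℕ.* (6 ℕ.* f))
      ∎
    where
    open ≡-Reasoning
    D₁≡ : + D₁ ≡ + 12 * (+ p * + N)
    D₁≡ = trans (ℤₚ.pos-* 12 (p ^ suc n)) (cong (+ 12 *_) (ℤₚ.pos-* p N))
    f′≡ph′ : + f′ ≡ + p * + h
    f′≡ph′ = trans (cong +_ f′≡ph) (ℤₚ.pos-* p h)
    common-denominator : ∀ P n H A D₁ F G → G ≡ P * H → F ≡ n * G → A ≡ (P * n + n - + 1) * F → D₁ ≡ + 12 * (P * n) →
      ((A * + 4 + - n * D₁) * (+ 6 * F) + n * (D₁ * + 4)) * (+ 12 * G) ≡ S-numerator n G H * ((D₁ * + 4) * (+ 6 * F))
    common-denominator P n H _ _ _ _ refl refl refl refl = polynomial P n H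
      where
      polynomial : ∀ P n H →
        (((P * n + n - + 1) * (n * (P * H)) * + 4 + - n * (+ 12 * (P * n))) * (+ 6 * (n * (P * H))) + n * ((+ 12 * (P * n)) * + 4))
          * (+ 12 * (P * H))
        ≡ (n * (P * H) * (P * H) - + 3 * n * (P * H) + n * (P * H) * H - (P * H) * H + + 2)
          * ((+ 12 * (P * n) * + 4) * (+ 6 * (n * (P * H))))
      polynomial = solve-∀

  paper-formula≃V/12f′ : toℚᵘ paper-formula ≃ V / (12 ℕ.* f′)
  paper-formula≃V/12f′ = ℚᵘₚ.≃-trans (toℚᵘ-[x-y]+z (+ A) (+ N) (+ N) D₁ 4 (6 ℕ.* f))
                                     (/-cross _ V (D₁ ℕ.* 4 ℕ.* (6 ℕ.* f)) (12 ℕ.* f′) paper-formula-cross)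

  S-formula : S ≡ paper-formula
  S-formula = ℚₚ.toℚᵘ-injective (ℚᵘₚ.≃-trans S≃V/12f′ (ℚᵘₚ.≃-sym paper-formula≃V/12f′))

  S-scaled : ∀ c u → c ℕ.* U ≡ 3 ℕ.* u → divQ (+ (2 ℕ.* c ℕ.* f)) N ℚ.* S ≡ divQ (+ u) 1
  S-scaled c u cU≡3u = ℚₚ.toℚᵘ-injective chain
    where
    instance
      12f′N≢0 : NonZero (N ℕ.* (12 ℕ.* f′))
      12f′N≢0 = ℕₚ.m*n≢0 N (12 ℕ.* f′)
    2cf≡ : + (2 ℕ.* c ℕ.* f) ≡ + 2 * + c * (+ N * + f′)
    2cf≡ = trans (ℤₚ.pos-* (2 ℕ.* c) f) (cong₂ _*_ (ℤₚ.pos-* 2 c) (ℤₚ.pos-* N f′))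
    gather : ∀ c N f′ U → (+ 2 * c * (N * f′)) * (+ 2 * U) * + 1 ≡ + 4 * N * f′ * (c * U)
    gather = solve-∀
    spread : ∀ u N f′ → + 4 * N * f′ * (+ 3 * u) ≡ u * (N * (+ 12 * f′))
    spread = solve-∀
    cross : (+ (2 ℕ.* c ℕ.* f) * V) * + 1 ≡ + u * + (N ℕ.* (12 ℕ.* f′))
    cross = begin
      (+ (2 ℕ.* c ℕ.* f) * V) * + 1                     ≡⟨ cong₂ (λ x y → x * y * + 1) 2cf≡ V≡2U ⟩
      (+ 2 * + c * (+ N * + f′)) * (+ 2 * + U) * + 1     ≡⟨ gather (+ c) (+ N) (+ f′) (+ U) ⟩
      + 4 * + N * + f′ * (+ c * + U)                     ≡⟨ cong (+ 4 * + N * + f′ *_) (trans (sym (ℤₚ.pos-* c U)) (trans (cong +_ cU≡3u) (ℤₚ.pos-* 3 u))) ⟩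
      + 4 * + N * + f′ * (+ 3 * + u)                     ≡⟨ spread (+ u) (+ N) (+ f′) ⟩
      + u * (+ N * (+ 12 * + f′))                        ≡⟨ cong (+ u *_) (sym (trans (ℤₚ.pos-* N (12 ℕ.* f′)) (cong (+ N *_) (ℤₚ.pos-* 12 f′)))) ⟩
      + u * + (N ℕ.* (12 ℕ.* f′))                        ∎
      where open ≡-Reasoning
    chain : toℚᵘ (divQ (+ (2 ℕ.* c ℕ.* f)) N ℚ.* S) ≃ toℚᵘ (divQ (+ u) 1)
    chain = begin
      toℚᵘ (divQ (+ (2 ℕ.* c ℕ.* f)) N ℚ.* S)             ≈⟨ ℚₚ.toℚᵘ-homo-* (divQ (+ (2 ℕ.* c ℕ.* f)) N) S ⟩
      toℚᵘ (divQ (+ (2 ℕ.* c ℕ.* f)) N) ℚᵘ.* toℚᵘ S       ≈⟨ ℚᵘₚ.*-cong (toℚᵘ-divQ (+ (2 ℕ.* c ℕ.* f)) N) S≃V/12f′ ⟩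
      (+ (2 ℕ.* c ℕ.* f) / N) ℚᵘ.* (V / (12 ℕ.* f′))      ≈⟨ /-* (+ (2 ℕ.* c ℕ.* f)) V N (12 ℕ.* f′) ⟩
      (+ (2 ℕ.* c ℕ.* f) * V) / (N ℕ.* (12 ℕ.* f′))       ≈⟨ /-cross _ (+ u) (N ℕ.* (12 ℕ.* f′)) 1 cross ⟩
      + u / 1                                             ≈⟨ ℚᵘₚ.≃-sym (toℚᵘ-divQ (+ u) 1) ⟩
      toℚᵘ (divQ (+ u) 1)                                 ∎
      where open ℚᵘₚ.≃-Reasoning


  scaled-S-integer : 3 ≤ p → ¬ 2 ∣ h →
    ∃ λ (z : ℤ) → (divQ (+ (2 ℕ.* gcd 3 f ℕ.* f)) N ℚ.* S ≡ divQ z 1) × ¬ (p ∣ ∣ z ∣) × ((¬ (2 ∣ ∣ z ∣)) ⇔ (f % 4 ≡ 3))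
  scaled-S-integer 3≤p 2∤h = from-third (third-of-gcd[3,m]* f (3∣U {p = p} {n = n} refl f′≡ph))
    where
    from-third : (∃ λ u → gcd 3 f ℕ.* U ≡ 3 ℕ.* u × (U ≡ u ⊎ U ≡ 3 ℕ.* u)) →
      ∃ λ (z : ℤ) → (divQ (+ (2 ℕ.* gcd 3 f ℕ.* f)) N ℚ.* S ≡ divQ z 1) × ¬ (p ∣ ∣ z ∣) × ((¬ (2 ∣ ∣ z ∣)) ⇔ (f % 4 ≡ 3))
    from-third (u , c*U≡3u , U≡u∨3u) =
      + u , S-scaled (gcd 3 f) u c*U≡3u , p∤u ,
      mk⇔ (λ 2∤u → Equivalence.to (U-odd⇔f%4≡3 2∤h) (2∤u ∘ 2∣-third U≡u∨3u))
          (λ f%4≡3 2∣u → Equivalence.from (U-odd⇔f%4≡3 2∤h) f%4≡3 (∣-third U≡u∨3u 2∣u))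
      where
      p∤u : ¬ p ∣ u
      p∤u p∣u = contradiction (divisor-of-f′-and-U (subst (p ∣_) (sym f′≡ph) (m∣m*n h)) (∣-third U≡u∨3u p∣u))
                              (λ p≡1 → contradiction (subst (3 ≤_) p≡1 3≤p) (λ { (s≤s ()) }))

open import Data.Nat using (_+_; _*_)
open import Data.Nat.DivMod using (_/_)
open KernelAndTrace
open SmallModuli

theorem5p3 : (p f′ n : ℕ) → Prime p → 3 ≤ p → 1 < f′ → ¬ (2 ∣ f′) → p ∣ f′ → 1 ≤ n →
    let f = p ^ n * f′ in
      -- H_{p^n} = {1 + k f' ; 0 ≤ k ≤ p^n - 1} is the kernel of (Z/f)^* → (Z/f')^*
      (∀ x → x < f → ((Coprime x f × (∃ λ q → x ≡ 1 + q * f′)) ⇔ (∃ λ k → k < p ^ n × x ≡ 1 + k * f′)))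
      -- T(H,f) = p^n + ((p^n - 1)/2) f
    × ΣN (p ^ n) (λ k → 1 + k * f′) ≡ p ^ n + ((p ^ n ∸ 1) / 2) * f
      -- gcd(f, T(H,f)) = p^n
    × gcd f (ΣN (p ^ n) (λ k → 1 + k * f′)) ≡ p ^ n
      -- S(H,f) formula
    × ΣQ (p ^ n) (λ k → dedekind (1 + k * f′) f)
        ≡ (divQ (+ ((p ^ suc n + p ^ n ∸ 1) * f)) (12 * p ^ suc n)
           ℚ.- divQ (+ (p ^ n)) 4)
           ℚ.+ divQ (+ (p ^ n)) (6 * f)
      -- 2 gcd(3,f) (f/p^n) S(H,f) is an integer, not divisible by p, odd iff f ≡ 3 mod 4
    × (∃ λ (z : ℤ) →
        (divQ (+ (2 * gcd 3 f * f)) (p ^ n) ℚ.* ΣQ (p ^ n) (λ k → dedekind (1 + k * f′) f)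
           ≡ divQ z 1)
        × ¬ (p ∣ ∣ z ∣)
        × ((¬ (2 ∣ ∣ z ∣)) ⇔ (f % 4 ≡ 3)))
theorem5p3 p f′ n p-prime 3≤p 1<f′ 2∤f′ p∣f′@(divides h f′≡hp) _
  with odd>1⇒3+2* 1<f′ 2∤f′ | odd-prime-power p-prime 3≤p n
... | a , f′≡3+2a | b , N≡1+2b =
  kernel-characterisation p∣f′ n , T-formula {b = b} N≡1+2b , gcd[f,T]≡N {b = b} N≡1+2b , S-formula , scaled-S-integer 3≤p 2∤h
  where
  instance
    h≢0 : NonZero h
    h≢0 = quotient≢0 p∣f′ {{ℕ.>-nonZero (ℕₚ.<-trans (s≤s z≤n) 1<f′)}}
  2∤h : ¬ 2 ∣ h
  2∤h = 2∤f′ ∘ subst (2 ∣_) (sym f′≡hp) ∘ ∣m⇒∣m*n p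
  open Formula {n = n} {a = a} {b = b} p-prime (trans f′≡hp (ℕₚ.*-comm h p)) N≡1+2b f′≡3+2a
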